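{- If $G$ is a connected claw-free graph of order $n > 14$, then $\gamma_t^d(G) \le 4n/7$, with equality if and only if $G \in \mathcal{H}$.
   Context: All graphs are finite and simple; claw-free means no induced $K_{1,3}$. For a graph $G$ with no isolated vertex, a set $S \subseteq V(G)$ is a disjunctive total dominating set if every vertex of $G$ either is adjacent to a vertex of $S$ or has at least two vertices of $S$ at distance exactly $2$ from it; $\gamma_t^d(G)$ is the minimum cardinality of such a set. For $t \ge 1$, $H_t$ is the graph obtained from a complete graph $K_t$ by, for each vertex $v$ of $K_t$, adding a new path $P_6$ (on six vertices) and joining $v$ to the two central vertices of that path; $\mathcal{H} = \{H_t : t \ge 1\}$. -}

module Defs where

open import Data.Nat using (ℕ; zero; suc; _<_; _≤_)
open import Data.Bool using (Bool; true; false)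
open import Data.Fin using (Fin; toℕ)
open import Data.Fin.Subset using (Subset; _∈_; ∣_∣)
open import Data.Product using (Σ; ∃; ∃-syntax; _×_; _,_)
open import Data.Sum using (_⊎_)
open import Relation.Nullary using (¬_)
open import Relation.Binary.PropositionalEquality using (_≡_; _≢_)
open import Function.Bundles using (_↔_; Inverse; _⇔_)

record Graph (n : ℕ) : Set where
  field
    adj    : Fin n → Fin n → Bool
    sym    : ∀ u v → adj u v ≡ adj v u
    irrefl : ∀ u → adj u u ≡ false

open Graph public

Adj : ∀ {n} → Graph n → Fin n → Fin n → Set
Adj G u v = adj G u v ≡ true

data Walk {n : ℕ} (G : Graph n) : Fin n → Fin n → ℕ → Set where
  nil  : ∀ {u} → Walk G u u 0
  cons : ∀ {u w v k} → Adj G u w → Walk G w v k → Walk G u v (suc k)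

Dist : ∀ {n} → Graph n → Fin n → Fin n → ℕ → Set
Dist G u v k = Walk G u v k × (∀ j → j < k → ¬ Walk G u v j)

Connected : ∀ {n} → Graph n → Set
Connected G = ∀ u v → ∃[ k ] Walk G u v k

ClawFree : ∀ {n} → Graph n → Set
ClawFree G = ∀ c x y z → Adj G c x → Adj G c y → Adj G c z →
  x ≢ y → x ≢ z → y ≢ z →
  ¬ (¬ Adj G x y × ¬ Adj G x z × ¬ Adj G y z)

IsDTDS : ∀ {n} → Graph n → Subset n → Set
IsDTDS G S = ∀ v →
  (∃[ u ] (u ∈ S × Adj G v u)) ⊎
  (∃[ u ] ∃[ w ] (u ∈ S × w ∈ S × u ≢ w × Dist G v u 2 × Dist G v w 2))

IsGammaTD : ∀ {n} → Graph n → ℕ → Set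
IsGammaTD {n} G k =
  (∃[ S ] (IsDTDS G S × ∣ S ∣ ≡ k)) × (∀ S → IsDTDS G S → k ≤ ∣ S ∣)

-- Adjacency of H_t on vertex set Fin t × Fin 7: (i , 0) is the clique
-- vertex i of K_t; (i , 1) … (i , 6) is the path P6 attached to it,
-- with (i , 3) and (i , 4) its two central vertices.
HAdj : ∀ {t} → Fin t × Fin 7 → Fin t × Fin 7 → Set
HAdj (i , a) (j , b) with toℕ a | toℕ b
... | zero  | zero  = i ≢ j
... | zero  | b'    = i ≡ j × (b' ≡ 3 ⊎ b' ≡ 4)
... | a'    | zero  = i ≡ j × (a' ≡ 3 ⊎ a' ≡ 4)
... | suc a' | suc b' = i ≡ j × (suc a' ≡ b' ⊎ suc b' ≡ a')

IsoH : ∀ {n} → Graph n → ℕ → Set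
IsoH {n} G t = Σ (Fin n ↔ (Fin t × Fin 7)) λ f →
  ∀ u v → (Adj G u v ⇔ HAdj (Inverse.to f u) (Inverse.to f v))

InH : ∀ {n} → Graph n → Set
InH G = ∃[ t ] (1 ≤ t × IsoH G t)

{-# OPTIONS --safe #-}
module Submission where

-- Replacing "at distance two" by "within distance two" does not change disjunctive
-- domination and makes it monotone in the edge set, so it may be bounded in a spanning
-- subgraph. In a depth-first search of a connected claw-free graph every vertex v has at
-- most two branches, and a parent of v is complete to v's clique in one of them. Hence G
-- has a spanning rooted forest in which siblings, together with their parent, form a
-- clique (a line graph of a tree). On such forests the minimum is governed by a tree
-- automaton: from the root clique one only needs how many of its vertices and of their
-- children are chosen, and how much domination they still lack. Normalised by 7|S| - 4n,
-- 24 tables suffice; every forest with n > 14 ends strictly below 0, except H_t rooted at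
-- an end of one of its P₆'s. So equality forces a spanning H_t, and since any additional
-- edge saves a vertex, G is H_t itself. Conversely each of the t units of H_t needs four
-- vertices of its own.

open import Defs hiding (sym)
open import Data.Nat as ℕ using (ℕ; zero; suc; _+_; _*_; _∸_; _≤_; _<_; _⊔_; z≤n; s≤s; _≤?_; _<?_)
open import Data.Nat.Properties
open import Data.Nat.Solver using (module +-*-Solver)
open import Data.Bool using (true; false)
import Data.Bool.Properties as Bool
open import Data.Fin using (Fin; zero; suc; toℕ; #_)
open import Data.Fin.Permutation using (↔⇒≡)
import Data.Fin.Properties as Fin
open import Data.Fin.Subset as Subset using (Subset; ⁅_⁆; _∪_; ∣_∣)
open import Data.Fin.Subset.Properties as Subset using (x∈p∪q⁺; x∈⁅x⁆; x∈p⇒∣p-x∣<∣p∣; x∈p∧x≢y⇒x∈p-y; anySubset?)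
open import Data.List as List using (List; []; _∷_; _++_; length; [_]; allFin; map; concatMap; cartesianProduct)
open import Data.List.Properties using (length-++; length-map; length-tabulate; ++-assoc; ++-identityʳ)
open import Data.List.Membership.Propositional using (_∈_; _∉_; find; lose)
open import Data.List.Membership.Propositional.Properties using (∈-lookup; ∈-++⁺ˡ; ∈-++⁺ʳ; ∈-++⁻; ∈-∃++; ∈-allFin; ∈-map⁺; ∈-map⁻; ∈-concatMap⁺; ∈-concatMap⁻; ∈-cartesianProduct⁺)
import Data.List.Membership.DecPropositional as DecMembership
open import Data.List.Relation.Unary.Any using (Any; here; there; any?)
open import Data.List.Relation.Unary.All as All using (All; []; _∷_; all?)
import Data.List.Relation.Unary.All.Properties as All
open import Data.List.Relation.Unary.AllPairs as AllPairs using (AllPairs; []; _∷_)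
open import Data.List.Relation.Unary.Unique.Propositional using (Unique)
open import Data.List.Relation.Unary.Unique.DecPropositional using (unique?)
import Data.List.Relation.Unary.Unique.Propositional.Properties as Unique
open import Data.List.Relation.Binary.Disjoint.Propositional using (Disjoint)
open import Data.List.Relation.Binary.Subset.Propositional using (_⊆_)
open import Data.List.Relation.Binary.Permutation.Propositional using (_↭_; refl; prep; swap; ↭-refl; ↭-reflexive; ↭-sym; ↭-trans; ↭⇒↭ₛ; module PermutationReasoning)
open import Data.List.Relation.Binary.Permutation.Propositional.Properties using (∈-resp-↭; ↭-length; ++⁺ˡ; ++⁺ʳ; shift; ++-comm)
import Data.List.Relation.Binary.Permutation.Setoid.Properties as Permutation
open import Data.Vec as Vec using (Vec; []; _∷_; lookup; toList; head)
import Data.Vec.Properties as Vec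
open import Data.Maybe as Maybe using (Maybe; just; nothing; Is-just; to-witness)
import Data.Maybe.Relation.Unary.Any as MaybeAny
open import Data.Product using (Σ; ∃; ∃-syntax; ∃₂; _×_; _,_; proj₁; proj₂)
open import Data.Product.Properties using (≡-dec)
open import Data.Sum using (_⊎_; inj₁; inj₂; [_,_]′)
open import Data.Unit using (⊤; tt)
open import Data.Empty using (⊥; ⊥-elim)
open import Function using (_∘_; id; case_of_)
open import Function.Bundles using (_⇔_; mk⇔; _↔_; Inverse; Equivalence; mk↔ₛ′)
open import Function.Construct.Composition using (_↔-∘_)
open import Function.Construct.Symmetry using (↔-sym)
open import Relation.Nullary using (¬_; Dec; yes; no; does; contradiction; ¬?; from-yes; from-no)
open import Relation.Nullary.Decidable using (_×-dec_; _⊎-dec_; _→-dec_; dec⇒maybe; dec-true; decidable-stable)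
open import Relation.Binary.Definitions using (Symmetric)
open import Relation.Binary.PropositionalEquality using (_≡_; _≢_; refl; sym; trans; cong; cong₂; subst; subst₂; setoid; module ≡-Reasoning)

unique-++⁻ : ∀ {A : Set} (xs : List A) {ys} → Unique (xs ++ ys) → Unique xs × Unique ys × Disjoint xs ys
unique-++⁻ [] u = [] , u , λ ()
unique-++⁻ (x ∷ xs) (x∉ ∷ u) with unique-++⁻ xs u
... | uxs , uys , d = All.++⁻ˡ xs x∉ ∷ uxs , uys ,
      λ { (here refl , y∈) → All.lookup (All.++⁻ʳ xs x∉) y∈ refl ; (there x∈ , y∈) → d (x∈ , y∈) }

-- Disjunctive domination by lists of vertices, with allowance for vertices still to be chosen.

module Domination {V : Set} (_~_ : V → V → Set) where

  -- Adjacent pairs with a common neighbour are included, unlike in Dist at 2.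
  Dist≤2 : V → V → Set
  Dist≤2 x u = u ≢ x × ∃[ y ] (x ~ y × y ~ u)

  -- Counting by a duplicate-free list of witnesses makes counts over disjoint sets additive.
  AtLeast : ℕ → (V → Set) → List V → Set
  AtLeast k P S = ∃[ us ] (Unique us × All (λ u → u ∈ S × P u) us × k ≤ length us)

  -- x becomes dominated by S as soon as k further vertices within distance two of x join S.
  Needs : ℕ → List V → V → Set
  Needs k S x = (∃[ u ] (u ∈ S × x ~ u)) ⊎ ∃[ j ] (2 ≤ k + j × AtLeast j (Dist≤2 x) S)

  Dominated : List V → V → Set
  Dominated = Needs 0

  atLeast-mono : ∀ {j k P Q S S′} → k ≤ j → S ⊆ S′ → (∀ {u} → u ∈ S → P u → Q u) → AtLeast j P S → AtLeast k Q S′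
  atLeast-mono k≤j S⊆ P⇒Q (us , u! , all , j≤) =
    us , u! , All.map (λ (u∈ , p) → S⊆ u∈ , P⇒Q u∈ p) all , ≤-trans k≤j j≤

  atLeast-++ : ∀ {j k P S₁ S₂} → Disjoint S₁ S₂ → AtLeast j P S₁ → AtLeast k P S₂ → AtLeast (j + k) P (S₁ ++ S₂)
  atLeast-++ {S₁ = S₁} S₁#S₂ (us , u! , us-all , j≤) (ws , w! , ws-all , k≤) =
    us ++ ws ,
    Unique.++⁺ u! w! (λ (v∈us , v∈ws) → S₁#S₂ (proj₁ (All.lookup us-all v∈us) , proj₁ (All.lookup ws-all v∈ws))) ,
    All.++⁺ (All.map (λ (u∈ , p) → ∈-++⁺ˡ u∈ , p) us-all) (All.map (λ (u∈ , p) → ∈-++⁺ʳ S₁ u∈ , p) ws-all) ,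
    ≤-trans (+-mono-≤ j≤ k≤) (≤-reflexive (sym (length-++ us)))

  atLeast-witness : ∀ {k P S} → 1 ≤ k → AtLeast k P S → ∃[ u ] (u ∈ S × P u)
  atLeast-witness (s≤s _) (u ∷ _ , _ , (u∈ , p) ∷ _ , _) = u , u∈ , p

  needs-mono : ∀ {j k S S′ x} → j ≤ k → S ⊆ S′ → Needs j S x → Needs k S′ x
  needs-mono j≤k S⊆ (inj₁ (u , u∈ , x~u)) = inj₁ (u , S⊆ u∈ , x~u)
  needs-mono j≤k S⊆ (inj₂ (i , 2≤ , al)) =
    inj₂ (i , ≤-trans 2≤ (+-monoˡ-≤ i j≤k) , atLeast-mono ≤-refl S⊆ (λ _ → id) al)

  needs-++ : ∀ {j k S₁ S₂ x} → Disjoint S₁ S₂ → Needs k S₁ x → AtLeast j (Dist≤2 x) S₂ → Needs (k ∸ j) (S₁ ++ S₂) x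
  needs-++ S₁#S₂ (inj₁ (u , u∈ , x~u)) al = inj₁ (u , ∈-++⁺ˡ u∈ , x~u)
  needs-++ {j} {k} S₁#S₂ (inj₂ (i , 2≤ , al₁)) al₂ = inj₂ (i + j , bound , atLeast-++ S₁#S₂ al₁ al₂)
    where
    open ≤-Reasoning
    bound : 2 ≤ k ∸ j + (i + j)
    bound = begin
      2                  ≤⟨ 2≤ ⟩
      k + i              ≤⟨ +-monoˡ-≤ i (m≤n+m∸n k j) ⟩
      j + (k ∸ j) + i    ≡⟨ solve 3 (λ a b c → a :+ b :+ c := b :+ (c :+ a)) refl j (k ∸ j) i ⟩
      k ∸ j + (i + j)    ∎
      where open +-*-Solver

-- Clique forests and what a chosen set achieves on them.

-- Left-child right-sibling encoding: node v K R is v with children K, beside its siblings R.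
data Forest (V : Set) : Set where
  ε    : Forest V
  node : (v : V) (kids sibs : Forest V) → Forest V

module _ {V : Set} where

  -- When a vertex is placed above or beside a forest, the tops become adjacent to it and the kids
  -- lie within distance two of it. The deep vertices gain nothing, so they must be dominated
  -- already.
  verts tops kids deep : Forest V → List V
  verts ε = []
  verts (node v K R) = v ∷ verts K ++ verts R
  tops ε = []
  tops (node v K R) = v ∷ tops R
  kids ε = []
  kids (node v K R) = tops K ++ kids R
  deep ε = []
  deep (node v K R) = (kids K ++ deep K) ++ deep R

  tops⊆verts : ∀ F → tops F ⊆ verts F
  tops⊆verts (node v K R) (here refl) = here refl
  tops⊆verts (node v K R) (there x∈) = there (∈-++⁺ʳ (verts K) (tops⊆verts R x∈))

  kids⊆verts : ∀ F → kids F ⊆ verts F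
  kids⊆verts (node v K R) x∈ with ∈-++⁻ (tops K) x∈
  ... | inj₁ x∈K = there (∈-++⁺ˡ (tops⊆verts K x∈K))
  ... | inj₂ x∈R = there (∈-++⁺ʳ (verts K) (kids⊆verts R x∈R))

  all-verts : ∀ {P : V → Set} F → All P (tops F) → All P (kids F) → All P (deep F) → All P (verts F)
  all-verts ε _ _ _ = []
  all-verts (node v K R) (pv ∷ ptR) pk pd =
    pv ∷ All.++⁺ (all-verts K (All.++⁻ˡ (tops K) pk) (All.++⁻ˡ (kids K) pdK) (All.++⁻ʳ (kids K) pdK))
                 (all-verts R ptR (All.++⁻ʳ (tops K) pk) (All.++⁻ʳ (kids K ++ deep K) pd))
    where pdK = All.++⁻ˡ (kids K ++ deep K) pd

-- What a set S of vertices of a forest F achieves: S contains topsIn tops and kidsIn kids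
-- of F, the tops and kids lack topNeed and kidNeed further vertices within distance two,
-- and 7|S| + credit ≤ 4|F| + debit.
record Entry : Set where
  constructor ⟨_,_,_,_⟩⟨_,_⟩
  field topsIn kidsIn topNeed kidNeed credit debit : ℕ
open Entry public

-- The need of a vertex: the first argument counts its chosen neighbours, the second the chosen
-- vertices within distance two.
lack : ℕ → ℕ → ℕ
lack zero    m = 2 ∸ m
lack (suc _) m = 0

-- The entry of node v K R from entries of K and R when v is left out of S, resp. put into S.
skip take : Entry → Entry → Entry
skip ⟨ a , m , t , k ⟩⟨ c , d ⟩ ⟨ a′ , m′ , t′ , k′ ⟩⟨ c′ , d′ ⟩ =
  ⟨ a′ , a + m′ , lack (a + a′) (m + m′) ⊔ (t′ ∸ a) , (t ∸ a′) ⊔ k′ ⟩⟨ 4 + (c + c′) , d + d′ ⟩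
take ⟨ a , m , t , k ⟩⟨ c , d ⟩ ⟨ a′ , m′ , t′ , k′ ⟩⟨ c′ , d′ ⟩ =
  ⟨ 1 + a′ , a + m′ , lack (a + a′) (m + m′) , k′ ∸ 1 ⟩⟨ 4 + (c + c′) , 7 + (d + d′) ⟩

module CliqueForest {V : Set} (_~_ : V → V → Set) (~-sym : Symmetric _~_) where
  open Domination _~_

  -- The tops and their parent `p` form a clique, and so on downwards. Only the presence of edges is
  -- demanded, so the forest may describe a spanning subgraph.
  Valid : V → Forest V → Set
  Valid p ε = ⊤
  Valid p (node v K R) = p ~ v × Valid v K × Valid p R × All (v ~_) (tops R)

  valid-tops : ∀ {p} F → Valid p F → All (p ~_) (tops F)
  valid-tops ε _ = []
  valid-tops (node v K R) (p~v , _ , vR , _) = p~v ∷ valid-tops R vR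

  kid-parent : ∀ {p x} F → Valid p F → x ∈ kids F → ∃[ t ] (t ∈ tops F × t ~ x)
  kid-parent (node v K R) (_ , vK , vR , _) x∈ with ∈-++⁻ (tops K) x∈
  ... | inj₁ x∈K = v , here refl , All.lookup (valid-tops K vK) x∈K
  ... | inj₂ x∈R with kid-parent R vR x∈R
  ...   | t , t∈ , t~x = t , there t∈ , t~x

  record Realizes (F : Forest V) (e : Entry) (S : List V) : Set where
    field
      inside   : S ⊆ verts F
      tops-in  : AtLeast (topsIn e) (_∈ tops F) S
      kids-in  : AtLeast (kidsIn e) (_∈ kids F) S
      tops-dom : All (Needs (topNeed e) S) (tops F)
      kids-dom : All (Needs (kidNeed e) S) (kids F)
      deep-dom : All (Dominated S) (deep F)
      cost     : 7 * length S + credit e ≤ 4 * length (verts F) + debit e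

  module Combine {p v K R} (vK : Valid v K) (vR : Valid p R) (v~R : All (v ~_) (tops R)) (uniq : Unique (verts (node v K R)))
                 {e e′ S S′} (rK : Realizes K e S) (rR : Realizes R e′ S′) where
    open Realizes
    v~K : All (v ~_) (tops K)
    v~K = valid-tops K vK
    v∉ : v ∉ verts K ++ verts R
    v∉ = Unique.Unique[x∷xs]⇒x∉xs uniq
    K#R : Disjoint (verts K) (verts R)
    K#R = proj₂ (proj₂ (unique-++⁻ (verts K) (AllPairs.tail uniq)))
    S#S′ : Disjoint S S′
    S#S′ (x∈ , y∈) = K#R (inside rK x∈ , inside rR y∈)
    S⊆ : S ⊆ S ++ S′
    S⊆ = ∈-++⁺ˡ
    S′⊆ : S′ ⊆ S ++ S′
    S′⊆ = ∈-++⁺ʳ S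
    v≢K : ∀ {x} → x ∈ verts K → x ≢ v
    v≢K x∈ refl = v∉ (∈-++⁺ˡ x∈)
    v≢R : ∀ {x} → x ∈ verts R → x ≢ v
    v≢R x∈ refl = v∉ (∈-++⁺ʳ (verts K) x∈)
    S++S′⊆ : S ++ S′ ⊆ verts (node v K R)
    S++S′⊆ x∈ with ∈-++⁻ S x∈
    ... | inj₁ y = there (∈-++⁺ˡ (inside rK y))
    ... | inj₂ y = there (∈-++⁺ʳ (verts K) (inside rR y))

    kids-in′ : AtLeast (topsIn e + kidsIn e′) (_∈ kids (node v K R)) (S ++ S′)
    kids-in′ = atLeast-++ S#S′ (atLeast-mono ≤-refl id (λ _ → ∈-++⁺ˡ) (tops-in rK))
                               (atLeast-mono ≤-refl id (λ _ → ∈-++⁺ʳ (tops K)) (kids-in rR))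

    root-needs : Needs (lack (topsIn e + topsIn e′) (kidsIn e + kidsIn e′)) (S ++ S′) v
    root-needs = by-cases (topsIn e + topsIn e′) adjacent
      where
      adjacent : AtLeast (topsIn e + topsIn e′) (v ~_) (S ++ S′)
      adjacent = atLeast-++ S#S′ (atLeast-mono ≤-refl id (λ _ → All.lookup v~K) (tops-in rK))
                                 (atLeast-mono ≤-refl id (λ _ → All.lookup v~R) (tops-in rR))
      near : AtLeast (kidsIn e + kidsIn e′) (Dist≤2 v) (S ++ S′)
      near = atLeast-++ S#S′
        (atLeast-mono ≤-refl id (λ _ x∈ → let t , t∈ , t~x = kid-parent K vK x∈ in
           v≢K (kids⊆verts K x∈) , t , All.lookup v~K t∈ , t~x) (kids-in rK))
        (atLeast-mono ≤-refl id (λ _ x∈ → let t , t∈ , t~x = kid-parent R vR x∈ in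
           v≢R (kids⊆verts R x∈) , t , All.lookup v~R t∈ , t~x) (kids-in rR))
      c = kidsIn e + kidsIn e′
      by-cases : ∀ a → AtLeast a (v ~_) (S ++ S′) → Needs (lack a (kidsIn e + kidsIn e′)) (S ++ S′) v
      by-cases zero    _ = inj₂ (c , subst (2 ≤_) (+-comm c (2 ∸ c)) (m≤n+m∸n 2 c) , near)
      by-cases (suc a) adj = inj₁ (atLeast-witness (s≤s z≤n) adj)

    -- The tops of `K` and those of `R` are within distance two of each other through `v`, so the
    -- chosen tops of each side lower the need of the other side. The kids of `K` become deep while
    -- `v` stays unchosen, hence they may lack nothing.
    realizes-skip : kidNeed e ≤ 0 → Realizes (node v K R) (skip e e′) (S ++ S′)
    realizes-skip k≤0 = record
      { inside   = S++S′⊆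
      ; tops-in  = atLeast-mono ≤-refl S′⊆ (λ _ → there) (tops-in rR)
      ; kids-in  = kids-in′
      ; tops-dom = needs-mono (m≤m⊔n _ _) id root-needs ∷
                   All.tabulate (λ x∈ → needs-mono (m≤n⊔m _ _) swap⊆
                     (needs-++ (λ (a , b) → S#S′ (b , a)) (All.lookup (tops-dom rR) x∈)
                       (atLeast-mono ≤-refl id (λ _ u∈ → (λ { refl → K#R (tops⊆verts K u∈ , tops⊆verts R x∈) }) ,
                          v , ~-sym (All.lookup v~R x∈) , All.lookup v~K u∈) (tops-in rK))))
      ; kids-dom = All.++⁺
                   (All.tabulate (λ x∈ → needs-mono (m≤m⊔n _ _) id
                     (needs-++ S#S′ (All.lookup (tops-dom rK) x∈)
                       (atLeast-mono ≤-refl id (λ _ u∈ → (λ { refl → K#R (tops⊆verts K x∈ , tops⊆verts R u∈) }) ,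
                          v , ~-sym (All.lookup v~K x∈) , All.lookup v~R u∈) (tops-in rR)))))
                   (All.map (needs-mono (m≤n⊔m _ _) S′⊆) (kids-dom rR))
      ; deep-dom = All.++⁺ (All.++⁺ (All.map (needs-mono k≤0 S⊆) (kids-dom rK)) (All.map (needs-mono ≤-refl S⊆) (deep-dom rK)))
                           (All.map (needs-mono ≤-refl S′⊆) (deep-dom rR))
      ; cost     = cost′
      }
      where
      swap⊆ : S′ ++ S ⊆ S ++ S′
      swap⊆ x∈ = [ S′⊆ , S⊆ ]′ (∈-++⁻ S′ x∈)
      open ≤-Reasoning
      open +-*-Solver
      -- The order grows by one, and the resulting 4 on the right pays for the added credit.
      cost′ : 7 * length (S ++ S′) + (4 + (credit e + credit e′)) ≤ 4 * length (verts (node v K R)) + (debit e + debit e′)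
      cost′ = begin
        7 * length (S ++ S′) + (4 + (credit e + credit e′))
          ≡⟨ cong (λ l → 7 * l + (4 + (credit e + credit e′))) (length-++ S) ⟩
        7 * (length S + length S′) + (4 + (credit e + credit e′))
          ≡⟨ solve 4 (λ a b c d → con 7 :* (a :+ b) :+ (con 4 :+ (c :+ d)) := con 4 :+ ((con 7 :* a :+ c) :+ (con 7 :* b :+ d)))
                refl (length S) (length S′) (credit e) (credit e′) ⟩
        4 + ((7 * length S + credit e) + (7 * length S′ + credit e′))
          ≤⟨ +-monoʳ-≤ 4 (+-mono-≤ (cost rK) (cost rR)) ⟩
        4 + ((4 * length (verts K) + debit e) + (4 * length (verts R) + debit e′))
          ≡⟨ solve 4 (λ a b c d → con 4 :+ ((con 4 :* a :+ c) :+ (con 4 :* b :+ d)) := con 4 :* (con 1 :+ (a :+ b)) :+ (c :+ d))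
                refl (length (verts K)) (length (verts R)) (debit e) (debit e′) ⟩
        4 * suc (length (verts K) + length (verts R)) + (debit e + debit e′)
          ≡⟨ cong (λ l → 4 * suc l + (debit e + debit e′)) (sym (length-++ (verts K))) ⟩
        4 * length (verts (node v K R)) + (debit e + debit e′) ∎

    -- A chosen `v` dominates all tops of `K` and `R` and counts once for their kids, which are
    -- within distance two. So the kids of `K`, about to become deep, may still lack one vertex. As
    -- `v` does not dominate itself, its own need remains.
    realizes-take : kidNeed e ≤ 1 → Realizes (node v K R) (take e e′) (v ∷ S ++ S′)
    realizes-take k≤1 = record
      { inside   = λ { (here refl) → here refl ; (there x∈) → S++S′⊆ x∈ }
      ; tops-in  = atLeast-++ {S₁ = [ v ]} (λ { (here refl , v∈) → v∉ (∈-S++S′ v∈) }) ([ v ] , [] ∷ [] , (here refl , here refl) ∷ [] , ≤-refl)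
                     (atLeast-mono ≤-refl S′⊆ (λ _ → there) (tops-in rR))
      ; kids-in  = atLeast-mono ≤-refl there (λ _ → id) kids-in′
      ; tops-dom = needs-mono ≤-refl there root-needs ∷ All.map (λ v~x → inj₁ (v , here refl , ~-sym v~x)) v~R
      ; kids-dom = All.++⁺ (All.map (λ v~x → inj₁ (v , here refl , ~-sym v~x)) v~K)
                   (All.tabulate (λ x∈ → let t , t∈ , t~x = kid-parent R vR x∈ in
                     needs-mono ≤-refl (λ y∈ → [ there ∘ S′⊆ , (λ { (here refl) → here refl }) ]′ (∈-++⁻ S′ y∈))
                       (needs-++ (λ { (v∈ , here refl) → v∉ (∈-++⁺ʳ (verts K) (inside rR v∈)) }) (All.lookup (kids-dom rR) x∈)
                         (just-v (v≢R (kids⊆verts R x∈) ∘ sym) (~-sym t~x) (~-sym (All.lookup v~R t∈))))))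
      ; deep-dom = All.++⁺ (All.++⁺
                     (All.tabulate (λ x∈ → let t , t∈ , t~x = kid-parent K vK x∈ in
                       needs-mono (∸-monoˡ-≤ 1 k≤1) (λ y∈ → [ there ∘ S⊆ , (λ { (here refl) → here refl }) ]′ (∈-++⁻ S y∈))
                       (needs-++ (λ { (v∈ , here refl) → v∉ (∈-++⁺ˡ (inside rK v∈)) }) (All.lookup (kids-dom rK) x∈)
                         (just-v (v≢K (kids⊆verts K x∈) ∘ sym) (~-sym t~x) (~-sym (All.lookup v~K t∈))))))
                     (All.map (needs-mono ≤-refl (there ∘ S⊆)) (deep-dom rK)))
                     (All.map (needs-mono ≤-refl (there ∘ S′⊆)) (deep-dom rR))
      ; cost     = cost′
      }
      where
      ∈-S++S′ : S ++ S′ ⊆ verts K ++ verts R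
      ∈-S++S′ x∈ with ∈-++⁻ S x∈
      ... | inj₁ y = ∈-++⁺ˡ (inside rK y)
      ... | inj₂ y = ∈-++⁺ʳ (verts K) (inside rR y)
      just-v : ∀ {x t} → v ≢ x → x ~ t → t ~ v → AtLeast 1 (Dist≤2 x) [ v ]
      just-v v≢x x~t t~v = [ v ] , [] ∷ [] , (here refl , v≢x , _ , x~t , t~v) ∷ [] , ≤-refl
      open ≤-Reasoning
      open +-*-Solver
      cost′ : 7 * length (v ∷ S ++ S′) + (4 + (credit e + credit e′)) ≤ 4 * length (verts (node v K R)) + (7 + (debit e + debit e′))
      cost′ = begin
        7 * suc (length (S ++ S′)) + (4 + (credit e + credit e′))
          ≡⟨ cong (λ l → 7 * suc l + (4 + (credit e + credit e′))) (length-++ S) ⟩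
        7 * suc (length S + length S′) + (4 + (credit e + credit e′))
          ≡⟨ solve 4 (λ a b c d → con 7 :* (con 1 :+ (a :+ b)) :+ (con 4 :+ (c :+ d)) := con 11 :+ ((con 7 :* a :+ c) :+ (con 7 :* b :+ d)))
                refl (length S) (length S′) (credit e) (credit e′) ⟩
        11 + ((7 * length S + credit e) + (7 * length S′ + credit e′))
          ≤⟨ +-monoʳ-≤ 11 (+-mono-≤ (cost rK) (cost rR)) ⟩
        11 + ((4 * length (verts K) + debit e) + (4 * length (verts R) + debit e′))
          ≡⟨ solve 4 (λ a b c d → con 11 :+ ((con 4 :* a :+ c) :+ (con 4 :* b :+ d)) := con 4 :* (con 1 :+ (a :+ b)) :+ (con 7 :+ (c :+ d)))
                refl (length (verts K)) (length (verts R)) (debit e) (debit e′) ⟩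
        4 * suc (length (verts K) + length (verts R)) + (7 + (debit e + debit e′))
          ≡⟨ cong (λ l → 4 * suc l + (7 + (debit e + debit e′))) (sym (length-++ (verts K))) ⟩
        4 * length (verts (node v K R)) + (7 + (debit e + debit e′)) ∎

-- The tree automaton and its finite checks.

-- Here `e` promises at least as much as `e′`. The last component compares credit minus debit,
-- written without subtraction.
_⊑_ : Entry → Entry → Set
e ⊑ e′ = topsIn e′ ≤ topsIn e × kidsIn e′ ≤ kidsIn e × topNeed e ≤ topNeed e′ × kidNeed e ≤ kidNeed e′
         × credit e′ + debit e ≤ credit e + debit e′

_⊑?_ : ∀ e e′ → Dec (e ⊑ e′)
e ⊑? e′ = (topsIn e′ ≤? topsIn e) ×-dec (kidsIn e′ ≤? kidsIn e) ×-dec (topNeed e ≤? topNeed e′) ×-dec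
          (kidNeed e ≤? kidNeed e′) ×-dec (credit e′ + debit e ≤? credit e + debit e′)

Table : Set
Table = List Entry

Yields : Entry → Entry → Entry → Set
Yields e e′ e″ = (kidNeed e ≤ 0 × skip e e′ ⊑ e″) ⊎ (kidNeed e ≤ 1 × take e e′ ⊑ e″)

-- Only entries kept in the target table need a derivation, so entries may be dropped or weakened;
-- this is what permits coarsening.
Covers : Table → Table → Table → Set
Covers t t′ = All λ e″ → Any (λ e → Any (λ e′ → Yields e e′ e″) t′) t

covers? : ∀ t t′ t″ → Dec (Covers t t′ t″)
covers? t t′ = all? λ e″ → any? (λ e → any? (λ e′ →
  ((kidNeed e ≤? 0) ×-dec (skip e e′ ⊑? e″)) ⊎-dec ((kidNeed e ≤? 1) ×-dec (take e e′ ⊑? e″))) t′) t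

-- The named labels are the subforests of H_t rooted at an end of a P₆: paths on at most
-- three vertices, units (a clique vertex with its P₆), the hub (the clique vertex of the
-- unit that contains the root), and the two stems below the root.
Label : Set
Label = Fin 24

pattern empty   = zero
pattern p₁      = suc empty
pattern p₂      = suc p₁
pattern p₃      = suc p₂
pattern p₃p₃    = suc p₃
pattern unit    = suc p₃p₃
pattern units   = suc unit
pattern hub     = suc units
pattern p₃hub   = suc hub
pattern stem₁   = suc p₃hub
pattern stem₂   = suc stem₁
pattern other i = suc (suc (suc (suc (suc (suc (suc (suc (suc (suc (suc i))))))))))

-- There are two rules for `p₃hub` because the clique vertex and the second central vertex of the
-- root's P₆ are siblings, listed in either order. The rules for `units` ensure at least two units.
data Step : Label → Label → Label → Set where
  p₁-step     : Step empty empty p₁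
  p₂-step     : Step p₁ empty p₂
  p₃-step     : Step p₂ empty p₃
  p₃p₃-step   : Step p₂ p₃ p₃p₃
  unit-step   : Step p₃p₃ empty unit
  units-step  : Step p₃p₃ unit units
  units-step′ : Step p₃p₃ units units
  hub-step    : Step units empty hub
  p₃hub-step  : Step p₂ hub p₃hub
  p₃hub-step′ : Step units p₃ p₃hub
  stem₁-step  : Step p₃hub empty stem₁
  stem₂-step  : Step stem₁ empty stem₂

step? : ∀ k r → Maybe (∃ (Step k r))
step? empty empty = just (_ , p₁-step)
step? p₁    empty = just (_ , p₂-step)
step? p₂    empty = just (_ , p₃-step)
step? p₂    p₃    = just (_ , p₃p₃-step)
step? p₂    hub   = just (_ , p₃hub-step)
step? p₃p₃  empty = just (_ , unit-step)
step? p₃p₃  unit  = just (_ , units-step)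
step? p₃p₃  units = just (_ , units-step′)
step? units empty = just (_ , hub-step)
step? units p₃    = just (_ , p₃hub-step′)
step? p₃hub empty = just (_ , stem₁-step)
step? stem₁ empty = just (_ , stem₂-step)
step? _     _     = nothing

-- Each label bounds the order of its forests (15 meaning no bound) and lists entries that
-- its forests realize. The list was found by closing the table of the empty forest under
-- skip and take and then coarsening it as far as closes permits.
states : Vec (ℕ × Table) 24
states =
    (0 , ⟨ 0 , 0 , 0 , 0 ⟩⟨ 0 , 0 ⟩ ∷ [])
  ∷ (1 , ⟨ 0 , 0 , 2 , 0 ⟩⟨ 4 , 0 ⟩ ∷ [])
  ∷ (2 , ⟨ 1 , 0 , 2 , 0 ⟩⟨ 1 , 0 ⟩ ∷ [])
  ∷ (3 , ⟨ 0 , 1 , 0 , 2 ⟩⟨ 5 , 0 ⟩ ∷ ⟨ 1 , 1 , 0 , 0 ⟩⟨ 0 , 2 ⟩ ∷ [])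
  ∷ (6 , ⟨ 1 , 2 , 0 , 1 ⟩⟨ 3 , 0 ⟩ ∷ [])
  ∷ (7 , ⟨ 1 , 1 , 0 , 0 ⟩⟨ 0 , 0 ⟩ ∷ [])
  ∷ (15 , ⟨ 2 , 2 , 0 , 0 ⟩⟨ 0 , 0 ⟩ ∷ [])
  ∷ (15 , ⟨ 0 , 2 , 0 , 0 ⟩⟨ 4 , 0 ⟩ ∷ [])
  ∷ (15 , ⟨ 1 , 2 , 0 , 0 ⟩⟨ 2 , 0 ⟩ ∷ [])
  ∷ (15 , ⟨ 0 , 1 , 0 , 0 ⟩⟨ 6 , 0 ⟩ ∷ ⟨ 1 , 1 , 0 , 0 ⟩⟨ 0 , 1 ⟩ ∷ [])
  ∷ (15 , ⟨ 1 , 0 , 1 , 0 ⟩⟨ 3 , 0 ⟩ ∷ [])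
  ∷ (3 , ⟨ 0 , 1 , 1 , 2 ⟩⟨ 5 , 0 ⟩ ∷ ⟨ 1 , 1 , 0 , 0 ⟩⟨ 0 , 2 ⟩ ∷ ⟨ 2 , 0 , 0 , 0 ⟩⟨ 0 , 3 ⟩ ∷ [])
  ∷ (4 , ⟨ 0 , 1 , 0 , 0 ⟩⟨ 2 , 0 ⟩ ∷ ⟨ 1 , 1 , 0 , 0 ⟩⟨ 0 , 5 ⟩ ∷ [])
  ∷ (7 , ⟨ 0 , 2 , 0 , 2 ⟩⟨ 3 , 0 ⟩ ∷ ⟨ 1 , 2 , 0 , 0 ⟩⟨ 0 , 0 ⟩ ∷ [])
  ∷ (8 , ⟨ 0 , 0 , 1 , 0 ⟩⟨ 4 , 0 ⟩ ∷ [])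
  ∷ (9 , ⟨ 0 , 0 , 2 , 1 ⟩⟨ 8 , 0 ⟩ ∷ [])
  ∷ (10 , ⟨ 1 , 0 , 2 , 1 ⟩⟨ 5 , 0 ⟩ ∷ [])
  ∷ (11 , ⟨ 1 , 0 , 1 , 0 ⟩⟨ 2 , 0 ⟩ ∷ [])
  ∷ (12 , ⟨ 0 , 1 , 0 , 1 ⟩⟨ 3 , 0 ⟩ ∷ ⟨ 1 , 1 , 0 , 1 ⟩⟨ 0 , 1 ⟩ ∷ ⟨ 1 , 1 , 1 , 0 ⟩⟨ 0 , 1 ⟩ ∷ [])
  ∷ (13 , ⟨ 0 , 1 , 0 , 1 ⟩⟨ 3 , 0 ⟩ ∷ ⟨ 1 , 0 , 1 , 0 ⟩⟨ 0 , 0 ⟩ ∷ [])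
  ∷ (15 , ⟨ 0 , 0 , 1 , 0 ⟩⟨ 0 , 1 ⟩ ∷ ⟨ 0 , 0 , 2 , 1 ⟩⟨ 3 , 0 ⟩ ∷ ⟨ 1 , 0 , 0 , 0 ⟩⟨ 0 , 3 ⟩ ∷ ⟨ 1 , 0 , 2 , 0 ⟩⟨ 0 , 3 ⟩ ∷ ⟨ 1 , 0 , 2 , 1 ⟩⟨ 0 , 0 ⟩ ∷ [])
  ∷ (15 , ⟨ 0 , 0 , 2 , 1 ⟩⟨ 6 , 0 ⟩ ∷ ⟨ 1 , 0 , 2 , 0 ⟩⟨ 4 , 0 ⟩ ∷ [])
  ∷ (15 , ⟨ 0 , 2 , 0 , 0 ⟩⟨ 5 , 0 ⟩ ∷ [])
  ∷ (15 , ⟨ 2 , 1 , 0 , 0 ⟩⟨ 1 , 0 ⟩ ∷ [])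
  ∷ []

cap : Label → ℕ
cap ℓ = proj₁ (lookup states ℓ)

table : Label → Table
table ℓ = proj₂ (lookup states ℓ)

Extends : Label → Label → Label → Set
Extends k r ℓ = (15 ≤ cap ℓ ⊎ suc (cap k + cap r) ≤ cap ℓ) × Covers (table k) (table r) (table ℓ)

extends? : ∀ k r ℓ → Dec (Extends k r ℓ)
extends? k r ℓ = ((15 ≤? cap ℓ) ⊎-dec (suc (cap k + cap r) ≤? cap ℓ)) ×-dec covers? (table k) (table r) (table ℓ)

-- A pair outside the grammar must land in an unnamed label, so a named label certifies how its
-- forest is built.
Next : Label → Label → Set
Next k r = ∃[ ℓ ] (Step k r ℓ × Extends k r ℓ) ⊎ ∃[ i ] Extends k r (other i)

next? : ∀ k r → Maybe (Next k r)
next? k r with step? k r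
next? k r | just (ℓ , s) = Maybe.map (λ e → inj₁ (ℓ , s , e)) (dec⇒maybe (extends? k r ℓ))
next? k r | nothing      = Maybe.map inj₂ (dec⇒maybe (Fin.any? λ i → extends? k r (other i)))

abstract
  -- The combinatorial core of the upper bound, settled by evaluating all 24 times 24 pairs of
  -- labels.
  next : ∀ k r → Next k r
  next k r = to-witness (check k r)
    where
    check : ∀ k r → Is-just (next? k r)
    check = from-yes (Fin.all? λ k → Fin.all? λ r → MaybeAny.dec (λ _ → yes tt) (next? k r))

-- The root enters as a node without siblings, hence `table empty`. The demanded entry leaves no
-- need open and asserts 7|S| + c ≤ 4n.
Closes : ℕ → Label → Set
Closes c ℓ = Covers (table ℓ) (table empty) [ ⟨ 0 , 0 , 0 , 0 ⟩⟨ c , 0 ⟩ ]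

closes? : ∀ c ℓ → Dec (Closes c ℓ)
closes? c ℓ = covers? (table ℓ) (table empty) [ ⟨ 0 , 0 , 0 , 0 ⟩⟨ c , 0 ⟩ ]

abstract
  -- Caps do not count the root, so a cap of at most 13 means n ≤ 14. The label `stem₂` describes
  -- everything below the root when the forest is H_t rooted at an end of a P₆.
  closes : ∀ ℓ → Closes 1 ℓ ⊎ (cap ℓ ≤ 13 ⊎ ℓ ≡ stem₂)
  closes = from-yes (Fin.all? λ ℓ → closes? 1 ℓ ⊎-dec ((cap ℓ ≤? 13) ⊎-dec (ℓ Fin.≟ stem₂)))

  closes-stem₂ : Closes 0 stem₂
  closes-stem₂ = from-yes (closes? 0 stem₂)

data Shape {V : Set} : Label → Forest V → Set where
  bare  : Shape empty ε
  grow  : ∀ {k r ℓ v K R} → Step k r ℓ → Shape k K → Shape r R → Shape ℓ (node v K R)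
  loose : ∀ {i F} → Shape (other i) F

-- Running the automaton: the bound for a single clique forest.

module Labelling {V : Set} (_~_ : V → V → Set) (~-sym : Symmetric _~_) where
  open Domination _~_
  open CliqueForest _~_ ~-sym

  Fits : Forest V → Table → Set
  Fits F = All λ e → ∃ (Realizes F e)

  realizes-⊑ : ∀ {F e e′ S} → e ⊑ e′ → Realizes F e S → Realizes F e′ S
  realizes-⊑ {F} {e} {e′} {S} (a , m , t , k , c) r = record
    { inside   = inside
    ; tops-in  = atLeast-mono a id (λ _ → id) tops-in
    ; kids-in  = atLeast-mono m id (λ _ → id) kids-in
    ; tops-dom = All.map (needs-mono t id) tops-dom
    ; kids-dom = All.map (needs-mono k id) kids-dom
    ; deep-dom = deep-dom
    -- Adding `credit e + debit e` to both sides replaces the subtraction; after regrouping, the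
    -- claim is the sum of `cost` and `c`.
    ; cost     = +-cancelʳ-≤ (credit e + debit e) _ _ (begin
        7 * length S + credit e′ + (credit e + debit e)
          ≡⟨ solve 4 (λ s c′ c d → s :+ c′ :+ (c :+ d) := (s :+ c) :+ (c′ :+ d))
                refl (7 * length S) (credit e′) (credit e) (debit e) ⟩
        7 * length S + credit e + (credit e′ + debit e)
          ≤⟨ +-mono-≤ cost c ⟩
        4 * length (verts F) + debit e + (credit e + debit e′)
          ≡⟨ solve 4 (λ s c d d′ → s :+ d :+ (c :+ d′) := (s :+ d′) :+ (c :+ d))
                refl (4 * length (verts F)) (credit e) (debit e) (debit e′) ⟩
        4 * length (verts F) + debit e′ + (credit e + debit e) ∎)
    }
    where
    open Realizes r
    open ≤-Reasoning
    open +-*-Solver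

  fits-node : ∀ {p v K R t t′ t″} → Valid v K → Valid p R → All (v ~_) (tops R) → Unique (verts (node v K R)) →
              Fits K t → Fits R t′ → Covers t t′ t″ → Fits (node v K R) t″
  fits-node vK vR v~R u fK fR = All.map λ any →
    let _ , e∈ , any′ = find any
        _ , e′∈ , yields = find any′
        _ , rK = All.lookup fK e∈
        _ , rR = All.lookup fR e′∈
        open Combine vK vR v~R u rK rR
    in [ (λ (k≤ , le) → _ , realizes-⊑ le (realizes-skip k≤)) , (λ (k≤ , le) → _ , realizes-⊑ le (realizes-take k≤)) ]′ yields

  record Labelled (F : Forest V) : Set where
    constructor labelled
    field
      label : Label
      shape : Shape label F
      fits  : Fits F (table label)
      size  : 15 ≤ cap label ⊎ length (verts F) ≤ cap label

  fits-ε : Fits ε (table empty)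
  fits-ε = ([] , record { inside = λ () ; tops-in = [] , [] , [] , z≤n ; kids-in = [] , [] , [] , z≤n
                        ; tops-dom = [] ; kids-dom = [] ; deep-dom = [] ; cost = z≤n }) ∷ []

  -- If `K` or `R` has no size bound, its cap is at least 15, and then the inequality between the
  -- caps makes `c` at least 15 too.
  size-node : ∀ (K R : Forest V) {k r c} → 15 ≤ c ⊎ suc (k + r) ≤ c → 15 ≤ k ⊎ length (verts K) ≤ k → 15 ≤ r ⊎ length (verts R) ≤ r →
              15 ≤ c ⊎ suc (length (verts K ++ verts R)) ≤ c
  size-node K R (inj₁ 15≤c) _ _ = inj₁ 15≤c
  size-node K R (inj₂ le) (inj₁ 15≤k) _ = inj₁ (≤-trans 15≤k (≤-trans (m≤m+n _ _) (<⇒≤ le)))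
  size-node K R (inj₂ le) _ (inj₁ 15≤r) = inj₁ (≤-trans 15≤r (≤-trans (m≤n+m _ _) (<⇒≤ le)))
  size-node K R (inj₂ le) (inj₂ K≤k) (inj₂ R≤r) =
    inj₂ (≤-trans (s≤s (≤-trans (≤-reflexive (length-++ (verts K))) (+-mono-≤ K≤k R≤r))) le)

  labelForest : ∀ {p} F → Valid p F → Unique (verts F) → Labelled F
  labelForest ε _ _ = labelled empty bare fits-ε (inj₂ z≤n)
  labelForest (node v K R) (_ , vK , vR , v~R) u@(_ ∷ u′)
    with uK , uR , _ ← unique-++⁻ (verts K) u′
    with labelled k sK fK zK ← labelForest K vK uK
    with labelled r sR fR zR ← labelForest R vR uR
    with next k r
  ... | inj₁ (ℓ , step , z , c) = labelled ℓ (grow step sK sR) (fits-node vK vR v~R u fK fR c) (size-node K R z zK zR)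
  ... | inj₂ (i , z , c) = labelled (other i) loose (fits-node vK vR v~R u fK fR c) (size-node K R z zK zR)

  close : ∀ {r F c} ℓ → Valid r F → Unique (r ∷ verts F) → Fits F (table ℓ) → Closes c ℓ →
          ∃[ S ] (All (Dominated S) (r ∷ verts F) × 7 * length S + c ≤ 4 * suc (length (verts F)))
  close {r} {F} {c} ℓ vF u fF closes
    with rewrite-++[] ← ++-identityʳ (verts F)
    -- The root is read as `node r F ε`; taking `r` as its formal parent is harmless because `Valid`
    -- asks nothing of `ε`.
    with (S , R) ∷ [] ← fits-node {p = r} {R = ε} vF tt [] (subst (Unique ∘ (r ∷_)) (sym rewrite-++[]) u) fF fits-ε closes
    = S , subst (All (Dominated S) ∘ (r ∷_)) rewrite-++[] (all-verts (node r F ε) tops-dom kids-dom deep-dom) ,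
      subst (λ vs → 7 * length S + c ≤ 4 * suc (length vs)) rewrite-++[] (≤-trans cost (≤-reflexive (+-identityʳ _)))
    where open Realizes R

  dominating : ∀ {r F} → Valid r F → Unique (r ∷ verts F) → 14 < suc (length (verts F)) →
    ∃[ S ] (All (Dominated S) (r ∷ verts F) × 7 * length S ≤ 4 * suc (length (verts F)) ×
            (7 * length S < 4 * suc (length (verts F)) ⊎ Shape stem₂ F))
  dominating {F = F} vF u 14<n with labelForest F vF (AllPairs.tail u)
  ... | labelled ℓ shape fits size with closes ℓ
  ...   | inj₁ strict with S , dom , c ← close ℓ vF u fits strict =
            S , dom , <⇒≤ lt , inj₁ lt
          where lt = subst (_≤ 4 * suc (length (verts F))) (+-comm (7 * length S) 1) c
  ...   | inj₂ (inj₂ refl) with S , dom , c ← close stem₂ vF u fits closes-stem₂ =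
            S , dom , subst (_≤ 4 * suc (length (verts F))) (+-identityʳ _) c , inj₂ shape
  ...   | inj₂ (inj₁ small) = contradiction 14<n (≤⇒≯ (s≤s (bounded size)))
          where
          bounded : 15 ≤ cap ℓ ⊎ length (verts F) ≤ cap ℓ → length (verts F) ≤ 13
          bounded (inj₁ big) = contradiction (≤-trans big small) (<⇒≱ (from-yes (13 <? 15)))
          bounded (inj₂ le)  = ≤-trans le small

-- Spanning clique forests of claw-free graphs by depth-first search.

unique-resp-↭ : ∀ {A : Set} {xs ys : List A} → xs ↭ ys → Unique xs → Unique ys
unique-resp-↭ {A} p = Permutation.Unique-resp-↭ (setoid A) (↭⇒↭ₛ p)

module Spanning {n} (G : Graph n) (claw-free : ClawFree G) where

  _~_ : Fin n → Fin n → Set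
  _~_ = Adj G

  ~-sym : ∀ {u v} → u ~ v → v ~ u
  ~-sym {u} {v} = trans (Graph.sym G v u)

  _~?_ : ∀ u v → Dec (u ~ v)
  u ~? v = adj G u v Bool.≟ true

  open CliqueForest _~_ ~-sym

  NoEdges : List (Fin n) → List (Fin n) → Set
  NoEdges xs ys = ∀ {x y} → x ∈ xs → y ∈ ys → ¬ x ~ y

  -- The outcome of a search from `v` within `A`: at most two branches, possibly empty, with no
  -- edges between them, and a remainder that neither `v` nor the branches touch.
  record Sprout (v : Fin n) (A : List (Fin n)) : Set where
    field
      left right  : Forest (Fin n)
      rest        : List (Fin n)
      valid-left  : Valid v left
      valid-right : Valid v right
      apart       : NoEdges (verts left) (verts right)
      split       : A ↭ (verts left ++ verts right) ++ rest
      closed      : NoEdges (v ∷ verts left ++ verts right) rest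

  -- The field `inner` remembers a neighbour of `v` in the branch, to serve as a leaf of a potential
  -- claw.
  record Branch (v : Fin n) (A : List (Fin n)) : Set where
    field
      forest : Forest (Fin n)
      rest   : List (Fin n)
      valid  : Valid v forest
      inner  : ∃[ c ] (c ∈ verts forest × v ~ c)
      split  : A ↭ verts forest ++ rest
      closed : NoEdges (verts forest) rest

  reparent : ∀ {v p} F → Valid v F → All (p ~_) (tops F) → Valid p F
  reparent ε _ _ = tt
  reparent (node u K R) (_ , vK , vR , u~R) (p~u ∷ p~R) = p~u , vK , reparent R vR p~R , u~R

  -- If p missed a top on either side, v would be the centre of a claw.
  complete-to-one : ∀ {p v} K R → p ~ v → Valid v K → Valid v R → NoEdges (verts K) (verts R) →
    Unique (p ∷ v ∷ verts K ++ verts R) → All (p ~_) (tops K) ⊎ All (p ~_) (tops R)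
  complete-to-one {p} {v} K R p~v vK vR K≁R (p∉ ∷ _ ∷ u) with all? (p ~?_) (tops K)
  ... | yes all = inj₁ all
  ... | no ¬all = inj₂ (All.tabulate λ {y} y∈ → case p ~? y of λ
          { (yes p~y) → p~y
          ; (no p≁y) → let x , x∈ , p≁x = find (All.¬All⇒Any¬ (p ~?_) (tops K) ¬all)
                           x∈′ = tops⊆verts K x∈
                           y∈′ = tops⊆verts R y∈ in
              ⊥-elim (claw-free v p x y (~-sym p~v) (All.lookup (valid-tops K vK) x∈) (All.lookup (valid-tops R vR) y∈)
                (All.lookup p∉ (there (∈-++⁺ˡ x∈′))) (All.lookup p∉ (there (∈-++⁺ʳ (verts K) y∈′)))
                (λ { refl → proj₂ (proj₂ (unique-++⁻ (verts K) u)) (x∈′ , y∈′) })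
                (p≁x , p≁y , K≁R x∈′ y∈′)) })

  -- The branch whose tops are all adjacent to `p` moves up to become the siblings of `v`; the other
  -- one stays below `v`.
  attach : ∀ {p v} K R → p ~ v → Valid v K → Valid v R → NoEdges (verts K) (verts R) →
    Unique (p ∷ v ∷ verts K ++ verts R) → ∃[ F ] (Valid p F × verts F ↭ v ∷ verts K ++ verts R)
  attach {p} {v} K R p~v vK vR K≁R u with complete-to-one K R p~v vK vR K≁R u
  ... | inj₁ p~K = node v R K , (p~v , vR , reparent K vK p~K , valid-tops K vK) , prep v (++-comm (verts R) (verts K))
  ... | inj₂ p~R = node v K R , (p~v , vK , reparent R vR p~R , valid-tops R vR) , refl

  rest-length : ∀ {A} (xs ys : List (Fin n)) → A ↭ xs ++ ys → length ys ≤ length A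
  rest-length xs ys p = ≤-trans (m≤n+m (length ys) (length xs)) (≤-reflexive (trans (sym (length-++ xs)) (sym (↭-length p))))

  split-unique : ∀ {v A} {xs ys : List (Fin n)} → A ↭ xs ++ ys → Unique (v ∷ A) → Unique (v ∷ ys) × Disjoint xs ys
  split-unique {xs = xs} p u with v∉ ∷ u′ ← unique-resp-↭ (prep _ p) u with _ , uys , d ← unique-++⁻ xs u′ =
    All.++⁻ʳ xs v∉ ∷ uys , d

  -- The number `m` is fuel: `branch` removes a neighbour `c` of `v` from `A` and searches on from
  -- `c` with one unit less.
  sprout : ∀ m v A → length A ≤ m → Unique (v ∷ A) → Sprout v A
  branch : ∀ m v A → length A ≤ m → Unique (v ∷ A) → Any (v ~_) A → Branch v A

  branch m v A A≤m u any with find any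
  ... | c , c∈ , v~c with ∈-∃++ c∈
  branch (suc m) v _ A≤m u any | c , c∈ , v~c | ys , zs , refl = record
    { forest = F ; rest = rest ; valid = vF
    ; inner  = c , ∈-resp-↭ (↭-sym F↭) (here refl) , v~c
    ; split  = ↭-trans perm (↭-trans (prep c split) (++⁺ʳ rest (↭-sym F↭)))
    ; closed = λ x∈ → closed (∈-resp-↭ F↭ x∈)
    }
    where
    perm : ys ++ c ∷ zs ↭ c ∷ ys ++ zs
    perm = shift c ys zs
    u′ : Unique (v ∷ c ∷ ys ++ zs)
    u′ = unique-resp-↭ (prep v perm) u
    open Sprout (sprout m c (ys ++ zs) (≤-pred (≤-trans (≤-reflexive (sym (↭-length perm))) A≤m)) (AllPairs.tail u′))
    u″ : Unique (v ∷ c ∷ (verts left ++ verts right) ++ rest)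
    u″ = unique-resp-↭ (prep v (prep c split)) u′
    att = attach left right v~c valid-left valid-right apart (proj₁ (unique-++⁻ (v ∷ c ∷ verts left ++ verts right) u″))
    F = proj₁ att
    vF = proj₁ (proj₂ att)
    F↭ = proj₂ (proj₂ att)
  branch zero v _ A≤m u any | c , c∈ , v~c | [] , zs , refl = contradiction A≤m λ ()
  branch zero v _ A≤m u any | c , c∈ , v~c | _ ∷ _ , zs , refl = contradiction A≤m λ ()

  sprout m v A A≤m u with any? (v ~?_) A
  ... | no none = record
    { left = ε ; right = ε ; rest = A ; valid-left = tt ; valid-right = tt ; apart = λ () ; split = refl
    ; closed = λ { (here refl) y∈ v~y → none (lose y∈ v~y) } }
  ... | yes any with branch m v A A≤m u any
  ... | B₁ with any? (v ~?_) (Branch.rest B₁)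
  ... | no none = record
    { left = forest ; right = ε ; rest = rest ; valid-left = valid ; valid-right = tt ; apart = λ _ ()
    ; split  = subst (λ vs → A ↭ vs ++ rest) (sym (++-identityʳ _)) split
    ; closed = λ { (here refl) y∈ v~y → none (lose y∈ v~y)
                 ; (there x∈) → closed (subst (_ ∈_) (++-identityʳ _) x∈) } }
    where open Branch B₁
  ... | yes any₂ with branch m v (Branch.rest B₁) (≤-trans (rest-length _ (Branch.rest B₁) (Branch.split B₁)) A≤m)
                             (proj₁ (split-unique (Branch.split B₁) u)) any₂
  ... | B₂ with any? (v ~?_) (Branch.rest B₂)
  ... | no none = record
    { left = B₁.forest ; right = B₂.forest ; rest = B₂.rest ; valid-left = B₁.valid ; valid-right = B₂.valid
    ; apart  = λ x∈ y∈ → B₁.closed x∈ (∈-resp-↭ (↭-sym B₂.split) (∈-++⁺ˡ y∈))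
    ; split  = ↭-trans B₁.split (↭-trans (++⁺ˡ (verts B₁.forest) B₂.split) (↭-reflexive (sym (++-assoc (verts B₁.forest) _ _))))
    ; closed = λ { (here refl) y∈ v~y → none (lose y∈ v~y)
                 ; (there x∈) y∈ → [ (λ x∈₁ → B₁.closed x∈₁ (∈-resp-↭ (↭-sym B₂.split) (∈-++⁺ʳ (verts B₂.forest) y∈)))
                                    , (λ x∈₂ → B₂.closed x∈₂ y∈) ]′ (∈-++⁻ (verts B₁.forest) x∈) } }
    where
    module B₁ = Branch B₁
    module B₂ = Branch B₂
  -- A neighbour of `v` outside both branches, together with one from each branch, would form a claw
  -- centred at `v`.
  ... | yes any₃ with c₁ , c₁∈ , v~c₁ ← Branch.inner B₁ | c₂ , c₂∈ , v~c₂ ← Branch.inner B₂ | c₃ , c₃∈ , v~c₃ ← find any₃ =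
    ⊥-elim (claw-free v c₁ c₂ c₃ v~c₁ v~c₂ v~c₃
      (λ { refl → F₁#rest (c₁∈ , c₂∈′) }) (λ { refl → F₁#rest (c₁∈ , c₃∈′) }) (λ { refl → F₂#rest (c₂∈ , c₃∈) })
      (B₁.closed c₁∈ c₂∈′ , B₁.closed c₁∈ c₃∈′ , B₂.closed c₂∈ c₃∈))
    where
    module B₁ = Branch B₁
    module B₂ = Branch B₂
    u₁ = split-unique B₁.split u
    F₁#rest = proj₂ u₁
    F₂#rest = proj₂ (split-unique B₂.split (proj₁ u₁))
    c₂∈′ = ∈-resp-↭ (↭-sym B₂.split) (∈-++⁺ˡ c₂∈)
    c₃∈′ = ∈-resp-↭ (↭-sym B₂.split) (∈-++⁺ʳ (verts B₂.forest) c₃∈)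

  -- Walking down to a top without kids, the clique containing it becomes the only clique at the root.
  reroot : ∀ r K R → Valid r K → Valid r R →
    ∃₂ λ r′ F → Valid r′ F × r′ ∷ verts F ↭ r ∷ verts K ++ verts R
  reroot r ε R _ vR = r , R , vR , refl
  reroot r (node c K′ R′) R (r~c , vK′ , vR′ , c~R′) vR
    with r′ , F , vF , p ← reroot c K′ (node r R R′) vK′
           (~-sym r~c , vR , reparent R′ vR′ c~R′ , valid-tops R′ vR′)
    = r′ , F , vF , ↭-trans p perm
    where
    open PermutationReasoning
    perm : c ∷ verts K′ ++ r ∷ verts R ++ verts R′ ↭ r ∷ (c ∷ verts K′ ++ verts R′) ++ verts R
    perm = begin
      c ∷ verts K′ ++ r ∷ verts R ++ verts R′    ↭⟨ prep c (shift r (verts K′) (verts R ++ verts R′)) ⟩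
      c ∷ r ∷ verts K′ ++ verts R ++ verts R′    ↭⟨ swap c r refl ⟩
      r ∷ c ∷ verts K′ ++ verts R ++ verts R′    ↭⟨ prep r (prep c (++⁺ˡ (verts K′) (++-comm (verts R) (verts R′)))) ⟩
      r ∷ c ∷ verts K′ ++ verts R′ ++ verts R    ≡⟨ cong (λ vs → r ∷ c ∷ vs) (sym (++-assoc (verts K′) (verts R′) (verts R))) ⟩
      r ∷ c ∷ (verts K′ ++ verts R′) ++ verts R  ∎

  -- A walk from `r` into the remainder would have to cross by an edge that `closed` excludes.
  sprout-spans : ∀ {r A} → Unique (r ∷ A) → (∀ x → x ∈ r ∷ A) → Connected G → (s : Sprout r A) → Sprout.rest s ≡ []
  sprout-spans {r} {A} u all connected s with Sprout.rest s in eq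
  ... | [] = refl
  ... | y ∷ _ = ⊥-elim (stuck (proj₂ (connected r y)) (here refl) (subst (y ∈_) (sym eq) (here refl)))
    where
    open Sprout s
    side : ∀ x → x ∈ r ∷ verts left ++ verts right ⊎ x ∈ rest
    side x = ∈-++⁻ (r ∷ verts left ++ verts right) (∈-resp-↭ (prep r split) (all x))
    stuck : ∀ {x y k} → Walk G x y k → x ∈ r ∷ verts left ++ verts right → y ∈ rest → ⊥
    stuck nil x∈ y∈ = proj₂ (proj₂ (unique-++⁻ (r ∷ verts left ++ verts right) (unique-resp-↭ (prep r split) u))) (x∈ , y∈)
    stuck (cons {w = w} x~w p) x∈ y∈ = [ (λ w∈ → stuck p w∈ y∈) , (λ w∈ → closed x∈ w∈ x~w) ]′ (side w)

  sprout⇒forest : ∀ {r A} → r ∷ A ↭ allFin n → Unique (r ∷ A) → Connected G → Sprout r A →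
    ∃₂ λ r F → Valid r F × r ∷ verts F ↭ allFin n
  sprout⇒forest {r} {A} p u connected s
    with r′ , F , vF , q ← reroot r (Sprout.left s) (Sprout.right s) (Sprout.valid-left s) (Sprout.valid-right s) =
    r′ , F , vF , ↭-trans q (↭-trans (prep r (↭-sym split′)) p)
    where
    open Sprout s
    no-rest : rest ≡ []
    no-rest = sprout-spans u (λ x → ∈-resp-↭ (↭-sym p) (∈-allFin x)) connected s
    split′ : A ↭ verts left ++ verts right
    split′ = subst (A ↭_) (trans (cong ((verts left ++ verts right) ++_) no-rest) (++-identityʳ _)) split

  abstract
    spanning-forest : ∀ {r A} → r ∷ A ↭ allFin n → Connected G → ∃₂ λ r F → Valid r F × r ∷ verts F ↭ allFin n
    spanning-forest {r} {A} p connected = sprout⇒forest p u connected (sprout (length A) r A ≤-refl u)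
      where
      u : Unique (r ∷ A)
      u = unique-resp-↭ (↭-sym p) (Unique.allFin⁺ n)

-- Rigidity: every edge added to H_t saves a vertex.

-- The clauses copy those of `HAdj` on positions, so that `hadj⁺` and `hadj⁻` can mostly pass proofs
-- through unchanged.
UnitAdjℕ : ℕ → ℕ → Set
UnitAdjℕ zero    b       = b ≡ 3 ⊎ b ≡ 4
UnitAdjℕ (suc a) zero    = suc a ≡ 3 ⊎ suc a ≡ 4
UnitAdjℕ (suc a) (suc b) = suc a ≡ b ⊎ suc b ≡ a

unitAdjℕ? : ∀ a b → Dec (UnitAdjℕ a b)
unitAdjℕ? zero    b       = (b ℕ.≟ 3) ⊎-dec (b ℕ.≟ 4)
unitAdjℕ? (suc a) zero    = (suc a ℕ.≟ 3) ⊎-dec (suc a ℕ.≟ 4)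
unitAdjℕ? (suc a) (suc b) = (suc a ℕ.≟ b) ⊎-dec (suc b ℕ.≟ a)

UnitAdj : Fin 7 → Fin 7 → Set
UnitAdj a b = UnitAdjℕ (toℕ a) (toℕ b)

unitAdj? : ∀ a b → Dec (UnitAdj a b)
unitAdj? a b = unitAdjℕ? (toℕ a) (toℕ b)

HAdj′ : ∀ {t} → Fin t × Fin 7 → Fin t × Fin 7 → Set
HAdj′ (i , a) (j , b) = (i ≡ j × UnitAdj a b) ⊎ (i ≢ j × a ≡ zero × b ≡ zero)

hadj⁺ : ∀ {t} {x y : Fin t × Fin 7} → HAdj′ x y → HAdj x y
hadj⁺ {x = i , zero}  {j , zero}  (inj₁ (refl , inj₁ ()))
hadj⁺ {x = i , zero}  {j , zero}  (inj₁ (refl , inj₂ ()))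
hadj⁺ {x = i , zero}  {j , zero}  (inj₂ (i≢j , _)) = i≢j
hadj⁺ {x = i , zero}  {j , suc b} (inj₁ e) = e
hadj⁺ {x = i , suc a} {j , zero}  (inj₁ e) = e
hadj⁺ {x = i , suc a} {j , suc b} (inj₁ e) = e

hadj⁻ : ∀ {t} {x y : Fin t × Fin 7} → HAdj x y → HAdj′ x y
hadj⁻ {x = i , zero}  {j , zero}  i≢j = inj₂ (i≢j , refl , refl)
hadj⁻ {x = i , zero}  {j , suc b} e = inj₁ e
hadj⁻ {x = i , suc a} {j , zero}  e = inj₁ e
hadj⁻ {x = i , suc a} {j , suc b} e = inj₁ e

hadj′? : ∀ {t} (x y : Fin t × Fin 7) → Dec (HAdj′ x y)
hadj′? (i , a) (j , b) = ((i Fin.≟ j) ×-dec unitAdj? a b) ⊎-dec (¬? (i Fin.≟ j) ×-dec (a Fin.≟ zero) ×-dec (b Fin.≟ zero))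

Node : Set
Node = Fin 3 × Fin 7

_≟ₙ_ : (x y : Node) → Dec (x ≡ y)
_≟ₙ_ = ≡-dec Fin._≟_ Fin._≟_

nodes : List Node
nodes = cartesianProduct (allFin 3) (allFin 7)

-- H₃ with the additional edge pq. Three units suffice: two for the ends of the edge, and
-- one whose chosen clique vertex helps to dominate them.
Plus : Node → Node → Node → Node → Set
Plus p q x y = HAdj′ x y ⊎ ((x ≡ p × y ≡ q) ⊎ (x ≡ q × y ≡ p))

plus? : ∀ p q x y → Dec (Plus p q x y)
plus? p q x y = hadj′? x y ⊎-dec (((x ≟ₙ p) ×-dec (y ≟ₙ q)) ⊎-dec ((x ≟ₙ q) ×-dec (y ≟ₙ p)))

module Pattern (p q : Node) where
  Near : Node → Node → Set
  Near x u = u ≢ x × Any (λ y → Plus p q x y × Plus p q y u) nodes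

  near? : ∀ x u → Dec (Near x u)
  near? x u = ¬? (u ≟ₙ x) ×-dec any? (λ y → plus? p q x y ×-dec plus? p q y u) nodes

  -- A counterpart of `Dominated` whose searches range over finite lists, so that it can be decided
  -- by evaluation.
  Hit : List Node → Node → Set
  Hit S x = Any (Plus p q x) S ⊎ Any (λ u → Near x u × Any (λ w → u ≢ w × Near x w) S) S

  hit? : ∀ S x → Dec (Hit S x)
  hit? S x = any? (plus? p q x) S ⊎-dec any? (λ u → near? x u ×-dec any? (λ w → ¬? (u ≟ₙ w) ×-dec near? x w) S) S

-- These four dominate their whole unit, vertex 5 by means of 0 and 3 at distance two. The chosen
-- clique vertex also dominates the clique vertices of all other units.
standard : List (Fin 7)
standard = # 0 ∷ # 2 ∷ # 3 ∷ # 5 ∷ []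

choose : List (Fin 7) × List (Fin 7) → Fin 3 → List (Fin 7)
choose (S , S′) zero       = S
choose (S , S′) (suc zero) = S′
choose (S , S′) _          = standard

place : (Fin 3 → List (Fin 7)) → List Node
place S = concatMap (λ m → map (m ,_) (S m)) (allFin 3)

-- Pairs of choices in units 0 and 1, with seven vertices in total instead of eight; every
-- edge that can be added to H₃ makes one of them dominating.
savings : List (List (Fin 7) × List (Fin 7))
savings = (# 2 ∷ # 3 ∷ # 5 ∷ [] , standard)
        ∷ (# 0 ∷ # 3 ∷ # 5 ∷ [] , standard)
        ∷ (# 2 ∷ # 4 ∷ # 5 ∷ [] , standard)
        ∷ (# 0 ∷ # 2 ∷ # 3 ∷ [] , # 2 ∷ # 3 ∷ # 5 ∷ # 6 ∷ [])
        ∷ (standard , # 2 ∷ # 3 ∷ # 5 ∷ [])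
        ∷ (standard , # 0 ∷ # 3 ∷ # 5 ∷ [])
        ∷ (standard , # 2 ∷ # 4 ∷ # 5 ∷ [])
        ∷ (# 0 ∷ # 2 ∷ # 4 ∷ # 5 ∷ [] , # 2 ∷ # 3 ∷ # 5 ∷ [])
        ∷ []

Saves : Node → Node → Set
Saves p q = Any (λ S → All (Pattern.Hit p q (place (choose S))) nodes) savings

saves? : ∀ p q → Dec (Saves p q)
saves? p q = any? (λ S → all? (Pattern.hit? p q (place (choose S))) nodes) savings

abstract
  -- Up to renaming units, a new edge lies inside unit 0 or runs between units 0 and 1; both cases
  -- are checked exhaustively.
  within-unit : ∀ a b → a ≢ b → ¬ UnitAdj a b → Saves (zero , a) (zero , b)
  within-unit = from-yes (Fin.all? λ a → Fin.all? λ b → ¬? (a Fin.≟ b) →-dec (¬? (unitAdj? a b) →-dec saves? (zero , a) (zero , b)))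

  between-units : ∀ a b → ¬ (a ≡ zero × b ≡ zero) → Saves (zero , a) (suc zero , b)
  between-units = from-yes (Fin.all? λ a → Fin.all? λ b → ¬? ((a Fin.≟ zero) ×-dec (b Fin.≟ zero)) →-dec saves? (zero , a) (suc zero , b))

third : ∀ {t} → 3 ≤ t → (i j : Fin t) → ∃[ k ] (k ≢ i × k ≢ j)
third (s≤s (s≤s (s≤s _))) zero          zero          = suc zero , (λ ()) , λ ()
third (s≤s (s≤s (s≤s _))) zero          (suc zero)    = suc (suc zero) , (λ ()) , λ ()
third (s≤s (s≤s (s≤s _))) zero          (suc (suc _)) = suc zero , (λ ()) , λ ()
third (s≤s (s≤s (s≤s _))) (suc zero)    zero          = suc (suc zero) , (λ ()) , λ ()
third (s≤s (s≤s (s≤s _))) (suc (suc _)) zero          = suc zero , (λ ()) , λ ()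
third (s≤s (s≤s (s≤s _))) (suc _)       (suc _)       = zero , (λ ()) , λ ()

length-concatMap-≤ : ∀ {A B : Set} (f : A → List B) {m} xs → (∀ x → length (f x) ≤ m) → length (concatMap f xs) ≤ m * length xs
length-concatMap-≤ f {m} [] _ = z≤n
length-concatMap-≤ f {m} (x ∷ xs) f≤ = begin
  length (f x ++ concatMap f xs)          ≡⟨ length-++ (f x) ⟩
  length (f x) + length (concatMap f xs)  ≤⟨ +-mono-≤ (f≤ x) (length-concatMap-≤ f xs f≤) ⟩
  m + m * length xs                       ≡⟨ sym (*-suc m (length xs)) ⟩
  m * length (x ∷ xs)                     ∎
  where open ≤-Reasoning

length-concatMap-< : ∀ {A B : Set} (f : A → List B) {m x xs} → (∀ x → length (f x) ≤ m) → x ∈ xs → length (f x) < m →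
                     length (concatMap f xs) < m * length xs
length-concatMap-< f {m} {x} {_ ∷ xs} f≤ (here refl) fx< = begin-strict
  length (f x ++ concatMap f xs)          ≡⟨ length-++ (f x) ⟩
  length (f x) + length (concatMap f xs)  <⟨ +-mono-<-≤ fx< (length-concatMap-≤ f xs f≤) ⟩
  m + m * length xs                       ≡⟨ sym (*-suc m (length xs)) ⟩
  m * length (x ∷ xs)                     ∎
  where open ≤-Reasoning
length-concatMap-< f {m} {x} {y ∷ xs} f≤ (there x∈) fx< = begin-strict
  length (f y ++ concatMap f xs)          ≡⟨ length-++ (f y) ⟩
  length (f y) + length (concatMap f xs)  <⟨ +-mono-≤-< (f≤ y) (length-concatMap-< f f≤ x∈ fx<) ⟩
  m + m * length xs                       ≡⟨ sym (*-suc m (length xs)) ⟩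
  m * length (y ∷ xs)                     ∎
  where open ≤-Reasoning

savings-size : All (λ (S , S′) → length S ≤ 4 × length S′ ≤ 4 × (length S < 4 ⊎ length S′ < 4)) savings
savings-size = from-yes (all? (λ (S , S′) → (length S ℕ.≤? 4) ×-dec (length S′ ℕ.≤? 4) ×-dec ((length S <? 4) ⊎-dec (length S′ <? 4))) savings)

-- The map `u` is a bijective homomorphism from H_t, that is, a spanning copy of H_t in a graph that
-- may have more edges.
module Rigidity {V : Set} (_~_ : V → V → Set) {t} (3≤t : 3 ≤ t) (u : Fin t × Fin 7 → V)
                (u-injective : ∀ {x y} → u x ≡ u y → x ≡ y) (u-surjective : ∀ v → ∃[ x ] u x ≡ v)
                (u-hom : ∀ {x y} → HAdj′ x y → u x ~ u y) (~-sym : Symmetric _~_) where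
  open Domination _~_

  module Saving {i j : Fin t} (i≢j : i ≢ j) (S S′ : List (Fin 7)) where

    selection : Fin t → List (Fin 7)
    selection k with k Fin.≟ i | k Fin.≟ j
    ... | yes _ | _     = S
    ... | no _  | yes _ = S′
    ... | no _  | no _  = standard

    selection-i : selection i ≡ S
    selection-i with i Fin.≟ i
    ... | yes _   = refl
    ... | no i≢i  = contradiction refl i≢i

    selection-j : selection j ≡ S′
    selection-j with j Fin.≟ i | j Fin.≟ j
    ... | yes j≡i | _      = contradiction (sym j≡i) i≢j
    ... | no _    | yes _  = refl
    ... | no _    | no j≢j = contradiction refl j≢j

    selection-k : ∀ {k} → k ≢ i → k ≢ j → selection k ≡ standard
    selection-k {k} k≢i k≢j with k Fin.≟ i | k Fin.≟ j
    ... | yes k≡i | _       = contradiction k≡i k≢i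
    ... | no _    | yes k≡j = contradiction k≡j k≢j
    ... | no _    | no _    = refl

    chosen : Fin t → List V
    chosen k = map (λ a → u (k , a)) (selection k)

    total : List V
    total = concatMap chosen (allFin t)

    total< : length S ≤ 4 → length S′ ≤ 4 → length S < 4 ⊎ length S′ < 4 → length total < 4 * t
    total< S≤4 S′≤4 or = subst (λ l → length total < 4 * l) {length (allFin t)} {t} (length-tabulate id) (strict or)
      where
      chosen-length : ∀ {k T} → selection k ≡ T → length (chosen k) ≡ length T
      chosen-length {k} eq = trans (length-map _ (selection k)) (cong length eq)
      chosen≤4 : ∀ k → length (chosen k) ≤ 4
      chosen≤4 k with k Fin.≟ i | k Fin.≟ j
      ... | yes refl | _        = ≤-trans (≤-reflexive (length-map _ S)) S≤4
      ... | no _     | yes refl = ≤-trans (≤-reflexive (length-map _ S′)) S′≤4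
      ... | no _     | no _     = ≤-refl
      strict : length S < 4 ⊎ length S′ < 4 → length total < 4 * length (allFin t)
      strict (inj₁ S<4)  = length-concatMap-< chosen chosen≤4 (∈-allFin i) (subst (_< 4) (sym (chosen-length selection-i)) S<4)
      strict (inj₂ S′<4) = length-concatMap-< chosen chosen≤4 (∈-allFin j) (subst (_< 4) (sym (chosen-length selection-j)) S′<4)

    module _ {k} (k≢i : k ≢ i) (k≢j : k ≢ j) where

      ι : Fin 3 → Fin t
      ι zero             = i
      ι (suc zero)       = j
      ι (suc (suc zero)) = k

      ι-injective : ∀ {l m} → ι l ≡ ι m → l ≡ m
      ι-injective {zero}           {zero}           _  = refl
      ι-injective {zero}           {suc zero}       eq = contradiction eq i≢j
      ι-injective {zero}           {suc (suc zero)} eq = contradiction (sym eq) k≢i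
      ι-injective {suc zero}       {zero}           eq = contradiction (sym eq) i≢j
      ι-injective {suc zero}       {suc zero}       _  = refl
      ι-injective {suc zero}       {suc (suc zero)} eq = contradiction (sym eq) k≢j
      ι-injective {suc (suc zero)} {zero}           eq = contradiction eq k≢i
      ι-injective {suc (suc zero)} {suc zero}       eq = contradiction eq k≢j
      ι-injective {suc (suc zero)} {suc (suc zero)} _  = refl

      φ : Node → V
      φ (m , a) = u (ι m , a)

      φ-injective : ∀ {x y} → φ x ≡ φ y → x ≡ y
      φ-injective {l , a} {m , b} eq with refl ← ι-injective {l} {m} (cong proj₁ (u-injective eq)) | refl ← cong proj₂ (u-injective eq) = refl

      ι-selection : ∀ m → selection (ι m) ≡ choose (S , S′) m
      ι-selection zero             = selection-i
      ι-selection (suc zero)       = selection-j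
      ι-selection (suc (suc zero)) = selection-k k≢i k≢j

      φ-total : ∀ {x} → x ∈ place (choose (S , S′)) → φ x ∈ total
      φ-total x∈ with m , m∈ , x∈m ← find (∈-concatMap⁻ (λ m → map (m ,_) (choose (S , S′) m)) {xs = allFin 3} x∈)
                 with a , a∈ , refl ← ∈-map⁻ (m ,_) x∈m =
        ∈-concatMap⁺ chosen (lose (∈-allFin (ι m)) (∈-map⁺ (λ a → u (ι m , a)) (subst (a ∈_) (sym (ι-selection m)) a∈)))

      module _ {p q} (extra : φ p ~ φ q) where
        open Pattern p q

        φ-hom : ∀ {x y} → Plus p q x y → φ x ~ φ y
        φ-hom (inj₁ (inj₁ (refl , e)))         = u-hom (inj₁ (refl , e))
        φ-hom (inj₁ (inj₂ (l≢m , a≡0 , b≡0))) = u-hom (inj₂ (l≢m ∘ ι-injective , a≡0 , b≡0))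
        φ-hom (inj₂ (inj₁ (refl , refl)))      = extra
        φ-hom (inj₂ (inj₂ (refl , refl)))      = ~-sym extra

        φ-near : ∀ {x w} → Near x w → Dist≤2 (φ x) (φ w)
        φ-near (w≢x , any) with y , _ , x~y , y~w ← find any = w≢x ∘ φ-injective , φ y , φ-hom x~y , φ-hom y~w

        φ-hit : ∀ {x} → Hit (place (choose (S , S′))) x → Dominated total (φ x)
        φ-hit (inj₁ any) with w , w∈ , x~w ← find any = inj₁ (φ w , φ-total w∈ , φ-hom x~w)
        φ-hit (inj₂ any) with w , w∈ , near , any′ ← find any with w′ , w′∈ , w≢w′ , near′ ← find any′ =
          inj₂ (2 , ≤-refl , φ w ∷ φ w′ ∷ [] , (w≢w′ ∘ φ-injective ∷ []) ∷ [] ∷ [] ,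
                (φ-total w∈ , φ-near near) ∷ (φ-total w′∈ , φ-near near′) ∷ [] , ≤-refl)

    -- Every vertex lies in some copy of H₃ formed by units `i`, `j` and a third one: a vertex of
    -- another unit uses its own unit as the third, and the finite check applies there.
    total-dominates : ∀ {p q} → (∀ {k} (k≢i : k ≢ i) (k≢j : k ≢ j) → φ k≢i k≢j p ~ φ k≢i k≢j q) →
      All (Pattern.Hit p q (place (choose (S , S′)))) nodes → ∀ v → Dominated total v
    total-dominates extra hits v with (m , a) , refl ← u-surjective v with m Fin.≟ i | m Fin.≟ j
    ... | no m≢i   | no m≢j = φ-hit m≢i m≢j (extra m≢i m≢j) (hit (suc (suc zero)) a)
      where
      hit : ∀ l a → Pattern.Hit _ _ (place (choose (S , S′))) (l , a)
      hit l a = All.lookup hits (∈-cartesianProduct⁺ (∈-allFin l) (∈-allFin a))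
    ... | yes refl | _ = let k , k≢i , k≢j = third 3≤t i j in
      φ-hit k≢i k≢j (extra k≢i k≢j) (All.lookup hits (∈-cartesianProduct⁺ (∈-allFin zero) (∈-allFin a)))
    ... | no _ | yes refl = let k , k≢i , k≢j = third 3≤t i j in
      φ-hit k≢i k≢j (extra k≢i k≢j) (All.lookup hits (∈-cartesianProduct⁺ (∈-allFin (suc zero)) (∈-allFin a)))

  module _ (irreflexive : ∀ {v} → ¬ v ~ v) (minimal : ∀ T → (∀ v → Dominated T v) → 4 * t ≤ length T) where

    no-saving : ∀ {i j p q} (i≢j : i ≢ j) → Saves p q →
      ¬ (∀ S S′ {k} (k≢i : k ≢ i) (k≢j : k ≢ j) → Saving.φ i≢j S S′ k≢i k≢j p ~ Saving.φ i≢j S S′ k≢i k≢j q)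
    no-saving i≢j saves extra with (S , S′) , S∈ , hits ← find saves with S≤ , S′≤ , lt ← All.lookup savings-size S∈ =
      <⇒≱ (total< S≤ S′≤ lt) (minimal total (total-dominates (extra S S′) hits))
      where open Saving i≢j S S′

    -- An edge outside H_t would allow a dominating list with fewer than `4 * t` members, against
    -- `minimal`.
    rigid : ∀ {x y} → u x ~ u y → HAdj′ x y
    rigid {x} {y} x~y with hadj′? x y
    rigid {x}     {y}     x~y | yes e = e
    rigid {i , a} {j , b} x~y | no ¬e with i Fin.≟ j
    ... | no i≢j = ⊥-elim (no-saving i≢j (between-units a b (λ (a≡0 , b≡0) → ¬e (inj₂ (i≢j , a≡0 , b≡0)))) (λ _ _ _ _ → x~y))
    -- For an edge inside one unit, any other unit plays the part of unit 1 in the finite check.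
    ... | yes refl = let k , k≢i , _ = third 3≤t i i in
      ⊥-elim (no-saving (k≢i ∘ sym) (within-unit a b (λ { refl → irreflexive x~y }) (λ e → ¬e (inj₁ (refl , e)))) (λ _ _ _ _ → x~y))

-- Reading a spanning H_t off a forest of shape `stem₂`.

unitEdges : List (Fin 7 × Fin 7)
unitEdges = (# 0 , # 3) ∷ (# 0 , # 4) ∷ (# 1 , # 2) ∷ (# 2 , # 3) ∷ (# 3 , # 4) ∷ (# 4 , # 5) ∷ (# 5 , # 6) ∷ []

unitAdj⇒edge : ∀ a b → UnitAdj a b → (a , b) ∈ unitEdges ⊎ (b , a) ∈ unitEdges
unitAdj⇒edge = from-yes (Fin.all? λ a → Fin.all? λ b → unitAdj? a b →-dec (((a , b) ∈? unitEdges) ⊎-dec ((b , a) ∈? unitEdges)))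
  where open DecMembership (≡-dec Fin._≟_ Fin._≟_) using (_∈?_)

module Unfolding {V : Set} (_~_ : V → V → Set) (~-sym : Symmetric _~_) where
  open CliqueForest _~_ ~-sym

  IsUnit : Vec V 7 → Set
  IsUnit x = ∀ a b → UnitAdj a b → lookup x a ~ lookup x b

  isUnit : ∀ {o a b c d e f} → o ~ c → o ~ d → a ~ b → b ~ c → c ~ d → d ~ e → e ~ f →
           IsUnit (o ∷ a ∷ b ∷ c ∷ d ∷ e ∷ f ∷ [])
  isUnit {o} {a} {b} {c} {d} {e} {f} oc od ab bc cd de ef i j adj =
    [ All.lookup edges , ~-sym ∘ All.lookup edges ]′ (unitAdj⇒edge i j adj)
    where
    edges : All (λ (i , j) → lookup (o ∷ a ∷ b ∷ c ∷ d ∷ e ∷ f ∷ []) i ~ lookup (o ∷ a ∷ b ∷ c ∷ d ∷ e ∷ f ∷ []) j) unitEdges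
    edges = oc ∷ od ∷ ab ∷ bc ∷ cd ∷ de ∷ ef ∷ []

  -- Through `hubs-in` the clique vertices are tops, so a further sibling or the parent is adjacent
  -- to all of them.
  record Units (vs : List V) (hubs : List V) : Set where
    field
      members : List (Vec V 7)
      areUnits : All IsUnit members
      hubs-adj : AllPairs (λ x y → head x ~ head y) members
      hubs-in : All (λ x → head x ∈ hubs) members
      partition : concatMap toList members ↭ vs

  reverse₃ : ∀ {a b c : V} {xs} → a ∷ b ∷ c ∷ xs ↭ c ∷ b ∷ a ∷ xs
  reverse₃ {a} {b} {c} = ↭-trans (swap a b refl) (↭-trans (prep b (swap a c refl)) (swap b c refl))

  addUnit : ∀ {p o K R} → Shape p₃p₃ K → Valid p (node o K R) → (us : Units (verts R) (tops R)) →
    ∃[ us′ ] (length (Units.members {verts (node o K R)} {tops (node o K R)} us′) ≡ suc (length (Units.members us)))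
  addUnit {o = o} {R = R}
    -- The tops `c` and `d` are adjacent siblings, which joins the two short paths below `o` to the
    -- P₆ on `a` to `f`.
    (grow {v = c} p₃p₃-step (grow {v = b} p₂-step (grow {v = a} p₁-step bare bare) bare)
      (grow {v = d} p₃-step (grow {v = e} p₂-step (grow {v = f} p₁-step bare bare) bare) bare))
    (_ , (o~c , (c~b , (b~a , _) , _) , (o~d , (d~e , (e~f , _) , _) , _) , c~d ∷ []) , _ , o~R) us = record
    { members = (o ∷ a ∷ b ∷ c ∷ d ∷ e ∷ f ∷ []) ∷ members
    ; areUnits = isUnit o~c o~d (~-sym b~a) (~-sym c~b) c~d d~e e~f ∷ areUnits
    ; hubs-adj = All.map (All.lookup o~R) hubs-in ∷ hubs-adj
    ; hubs-in = here refl ∷ All.map there hubs-in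
    ; partition = prep o (↭-trans reverse₃ (++⁺ˡ (c ∷ b ∷ a ∷ d ∷ e ∷ f ∷ []) partition))
    } , refl
    where open Units us

  unfold-unit : ∀ {p R} → Shape unit R → Valid p R → Σ (Units (verts R) (tops R)) λ us → 1 ≤ length (Units.members us)
  unfold-unit (grow unit-step sK bare) v =
    let us , eq = addUnit sK v record { members = [] ; areUnits = [] ; hubs-adj = [] ; hubs-in = [] ; partition = refl }
    in us , ≤-reflexive (sym eq)

  unfold-units : ∀ {p R} → Shape units R → Valid p R → Σ (Units (verts R) (tops R)) λ us → 2 ≤ length (Units.members us)
  unfold-units (grow units-step sK sR) v@(_ , _ , vR , _) =
    let us , 1≤ = unfold-unit sR vR ; us′ , eq = addUnit sK v us in us′ , ≤-trans (s≤s 1≤) (≤-reflexive (sym eq))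
  unfold-units (grow units-step′ sK sR) v@(_ , _ , vR , _) =
    let us , 2≤ = unfold-units sR vR ; us′ , eq = addUnit sK v us in us′ , ≤-trans (s≤s (<⇒≤ 2≤)) (≤-reflexive (sym eq))

  record SpanningH (vs : List V) : Set where
    field
      members   : List (Vec V 7)
      3≤members   : 3 ≤ length members
      areUnits  : All IsUnit members
      hubs-adj  : AllPairs (λ x y → head x ~ head y) members
      partition : concatMap toList members ↭ vs

  -- The root `a` is an end of the P₆ of its unit, with `c` and `d` central; the two clauses are the
  -- two orders of the siblings `o` and `d`. This unit and the at least two below `o` give the three
  -- that rigidity requires.
  spanningH : ∀ {r F vs} → Shape stem₂ F → Valid r F → r ∷ verts F ↭ vs → SpanningH vs
  spanningH {a} (grow {v = b} stem₂-step (grow {v = c} stem₁-step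
      (grow {v = d} p₃hub-step (grow {v = e} p₂-step (grow {v = f} p₁-step bare bare) bare)
        (grow {v = o} {K = U} hub-step sU bare)) bare) bare)
    (a~b , (b~c , (c~d , (d~e , (e~f , _) , _) , (c~o , vU , _) , d~o ∷ []) , _) , _) perm with us , 2≤ ← unfold-units sU vU = record
      { members   = (o ∷ a ∷ b ∷ c ∷ d ∷ e ∷ f ∷ []) ∷ Units.members us
      ; 3≤members   = s≤s 2≤
      ; areUnits  = isUnit (~-sym c~o) (~-sym d~o) a~b b~c c~d d~e e~f ∷ Units.areUnits us
      ; hubs-adj  = All.map (All.lookup (valid-tops U vU)) (Units.hubs-in us) ∷ Units.hubs-adj us
      ; partition = ↭-trans (↭-trans (↭-trans (↭-sym (shift o (a ∷ b ∷ c ∷ d ∷ e ∷ f ∷ []) _)) (++⁺ˡ (a ∷ b ∷ c ∷ d ∷ e ∷ f ∷ o ∷ []) (Units.partition us)))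
                      (↭-reflexive (cong (λ vs → a ∷ b ∷ c ∷ d ∷ e ∷ f ∷ o ∷ vs) (sym (trans (++-identityʳ _) (trans (++-identityʳ _) (++-identityʳ _))))))) perm
      }
  spanningH {a} (grow {v = b} stem₂-step (grow {v = c} stem₁-step
      (grow {v = o} {K = U} p₃hub-step′ sU
        (grow {v = d} p₃-step (grow {v = e} p₂-step (grow {v = f} p₁-step bare bare) bare) bare)) bare) bare)
    (a~b , (b~c , (c~o , vU , (c~d , (d~e , (e~f , _) , _) , _) , o~d ∷ []) , _) , _) perm with us , 2≤ ← unfold-units sU vU = record
      { members   = (o ∷ a ∷ b ∷ c ∷ d ∷ e ∷ f ∷ []) ∷ Units.members us
      ; 3≤members   = s≤s 2≤
      ; areUnits  = isUnit (~-sym c~o) o~d a~b b~c c~d d~e e~f ∷ Units.areUnits us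
      ; hubs-adj  = All.map (All.lookup (valid-tops U vU)) (Units.hubs-in us) ∷ Units.hubs-adj us
      ; partition = ↭-trans (↭-trans (↭-trans (↭-sym (shift o (a ∷ b ∷ c ∷ []) _)) (prep a (prep b (prep c (prep o
                        (↭-trans (++-comm (d ∷ e ∷ f ∷ []) _) (++⁺ʳ (d ∷ e ∷ f ∷ []) (Units.partition us))))))))
                      (↭-reflexive (cong (λ vs → a ∷ b ∷ c ∷ vs) (sym (trans (++-identityʳ _) (++-identityʳ _)))))) perm
      }

-- Coordinates for vertices from a partition into units.

allPairs-lookup : ∀ {A : Set} {R : A → A → Set} → Symmetric R → ∀ {xs} → AllPairs R xs →
                  ∀ {i j} → i ≢ j → R (List.lookup xs i) (List.lookup xs j)
allPairs-lookup R-sym (px ∷ pxs) {zero}  {zero}  i≢j = contradiction refl i≢j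
allPairs-lookup R-sym (px ∷ pxs) {zero}  {suc j} i≢j = All.lookup px (∈-lookup j)
allPairs-lookup R-sym (px ∷ pxs) {suc i} {zero}  i≢j = R-sym (All.lookup px (∈-lookup i))
allPairs-lookup R-sym (px ∷ pxs) {suc i} {suc j} i≢j = allPairs-lookup R-sym pxs (i≢j ∘ cong suc)

module _ {A : Set} where

  lookup∈toList : ∀ {m} (x : Vec A m) i → lookup x i ∈ toList x
  lookup∈toList (x ∷ xs) zero    = here refl
  lookup∈toList (x ∷ xs) (suc i) = there (lookup∈toList xs i)

  toList∋⇒lookup : ∀ {m v} (x : Vec A m) → v ∈ toList x → ∃[ i ] lookup x i ≡ v
  toList∋⇒lookup (x ∷ xs) (here refl) = zero , refl
  toList∋⇒lookup (x ∷ xs) (there v∈) with i , eq ← toList∋⇒lookup xs v∈ = suc i , eq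

  lookup-injective : ∀ {m} (x : Vec A m) → Unique (toList x) → ∀ {i j} → lookup x i ≡ lookup x j → i ≡ j
  lookup-injective (x ∷ xs) (x∉ ∷ u) {zero}  {zero}  eq = refl
  lookup-injective (x ∷ xs) (x∉ ∷ u) {zero}  {suc j} eq = contradiction eq (All.lookup x∉ (lookup∈toList xs j))
  lookup-injective (x ∷ xs) (x∉ ∷ u) {suc i} {zero}  eq = contradiction (sym eq) (All.lookup x∉ (lookup∈toList xs i))
  lookup-injective (x ∷ xs) (x∉ ∷ u) {suc i} {suc j} eq = cong suc (lookup-injective xs u eq)

  entry : ∀ {m} (xs : List (Vec A m)) → Fin (length xs) × Fin m → A
  entry xs (i , a) = lookup (List.lookup xs i) a

  entry∈ : ∀ {m} (xs : List (Vec A m)) i a → entry xs (i , a) ∈ concatMap toList xs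
  entry∈ (x ∷ xs) zero    a = ∈-++⁺ˡ (lookup∈toList x a)
  entry∈ (x ∷ xs) (suc i) a = ∈-++⁺ʳ (toList x) (entry∈ xs i a)

  entry-surjective : ∀ {m v} (xs : List (Vec A m)) → v ∈ concatMap toList xs → ∃[ p ] entry xs p ≡ v
  entry-surjective (x ∷ xs) v∈ with ∈-++⁻ (toList x) v∈
  ... | inj₁ v∈x with a , eq ← toList∋⇒lookup x v∈x = (zero , a) , eq
  ... | inj₂ v∈xs with (i , a) , eq ← entry-surjective xs v∈xs = (suc i , a) , eq

  entry-injective : ∀ {m} (xs : List (Vec A m)) → Unique (concatMap toList xs) → ∀ {p q} → entry xs p ≡ entry xs q → p ≡ q
  entry-injective (x ∷ xs) u {i , a} {j , b} eq with ux , uxs , x#xs ← unique-++⁻ (toList x) u with i | j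
  ... | zero   | zero   = cong (zero ,_) (lookup-injective x ux eq)
  ... | zero   | suc j′ = ⊥-elim (x#xs (lookup∈toList x a , subst (_∈ concatMap toList xs) (sym eq) (entry∈ xs j′ b)))
  ... | suc i′ | zero   = ⊥-elim (x#xs (lookup∈toList x b , subst (_∈ concatMap toList xs) eq (entry∈ xs i′ a)))
  ... | suc i′ | suc j′ = cong (λ (k , c) → suc k , c) (entry-injective xs uxs {i′ , a} {j′ , b} eq)

  length-concatMap-toList : ∀ {m} (xs : List (Vec A m)) → length (concatMap toList xs) ≡ m * length xs
  length-concatMap-toList {m} [] = sym (*-zeroʳ m)
  length-concatMap-toList {m} (x ∷ xs) = begin
    length (toList x ++ concatMap toList xs)         ≡⟨ length-++ (toList x) ⟩
    length (toList x) + length (concatMap toList xs) ≡⟨ cong₂ _+_ (Vec.length-toList x) (length-concatMap-toList xs) ⟩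
    m + m * length xs                                ≡⟨ sym (*-suc m (length xs)) ⟩
    m * length (x ∷ xs)                              ∎
    where open ≡-Reasoning

-- From dominating lists to disjunctive total dominating sets.

fromList : ∀ {n} → List (Fin n) → Subset n
fromList = List.foldr (λ x p → ⁅ x ⁆ ∪ p) Subset.⊥

∈-fromList : ∀ {n} {x : Fin n} {xs} → x ∈ xs → x Subset.∈ fromList xs
∈-fromList {xs = x ∷ xs} (here refl) = x∈p∪q⁺ (inj₁ (x∈⁅x⁆ x))
∈-fromList {xs = x ∷ xs} (there x∈)  = x∈p∪q⁺ (inj₂ (∈-fromList x∈))

∣⁅x⁆∪p∣≤1+∣p∣ : ∀ {n} (x : Fin n) p → ∣ ⁅ x ⁆ ∪ p ∣ ≤ suc ∣ p ∣
∣⁅x⁆∪p∣≤1+∣p∣ zero (true ∷ p)  = ≤-trans (≤-reflexive (cong (suc ∘ ∣_∣) (Subset.∪-identityˡ p))) (n≤1+n _)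
∣⁅x⁆∪p∣≤1+∣p∣ zero (false ∷ p) = ≤-reflexive (cong (suc ∘ ∣_∣) (Subset.∪-identityˡ p))
∣⁅x⁆∪p∣≤1+∣p∣ (suc x) (true ∷ p)  = s≤s (∣⁅x⁆∪p∣≤1+∣p∣ x p)
∣⁅x⁆∪p∣≤1+∣p∣ (suc x) (false ∷ p) = ∣⁅x⁆∪p∣≤1+∣p∣ x p

∣fromList∣≤length : ∀ {n} (xs : List (Fin n)) → ∣ fromList xs ∣ ≤ length xs
∣fromList∣≤length {n} []   = ≤-reflexive (Subset.∣⊥∣≡0 n)
∣fromList∣≤length (x ∷ xs) = ≤-trans (∣⁅x⁆∪p∣≤1+∣p∣ x (fromList xs)) (s≤s (∣fromList∣≤length xs))

unique-length : ∀ {n} {p : Subset n} {xs} → Unique xs → All (Subset._∈ p) xs → length xs ≤ ∣ p ∣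
unique-length [] [] = z≤n
unique-length {p = p} {x ∷ xs} (x∉ ∷ u) (x∈ ∷ xs∈) =
  ≤-trans (s≤s (unique-length u (All.zipWith (λ (x≢y , y∈) → x∈p∧x≢y⇒x∈p-y y∈ (x≢y ∘ sym)) (x∉ , xs∈)))) (x∈p⇒∣p-x∣<∣p∣ x∈)

module _ {n} (G : Graph n) where
  open Domination (Adj G)

  -- If one of two chosen vertices within distance two is adjacent to `v`, it dominates `v` alone;
  -- otherwise both are at distance exactly two.
  dominated⇒DTDS : ∀ S → (∀ v → Dominated S v) → IsDTDS G (fromList S)
  dominated⇒DTDS S dom v with dom v
  ... | inj₁ (u , u∈ , v~u) = inj₁ (u , ∈-fromList u∈ , v~u)
  ... | inj₂ (_ , 2≤j , [] , _ , _ , j≤) = contradiction (≤-trans 2≤j j≤) λ ()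
  ... | inj₂ (_ , 2≤j , u ∷ [] , _ , _ , j≤) = contradiction (≤-trans 2≤j j≤) λ { (s≤s ()) }
  ... | inj₂ (_ , _ , u ∷ w ∷ _ , (u≢w ∷ _) ∷ _ , (u∈ , near-u) ∷ (w∈ , near-w) ∷ _ , _)
    with adj G v u Bool.≟ true | adj G v w Bool.≟ true
  ...   | yes v~u | _       = inj₁ (u , ∈-fromList u∈ , v~u)
  ...   | no _    | yes v~w = inj₁ (w , ∈-fromList w∈ , v~w)
  ...   | no v≁u  | no v≁w  = inj₂ (u , w , ∈-fromList u∈ , ∈-fromList w∈ , u≢w , dist-2 near-u v≁u , dist-2 near-w v≁w)
    where
    dist-2 : ∀ {x} → Dist≤2 v x → ¬ Adj G v x → Dist G v x 2
    dist-2 (x≢v , y , v~y , y~x) v≁x = cons v~y (cons y~x nil) , λ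
      { 0 _ nil → x≢v refl
      ; 1 _ (cons v~x nil) → v≁x v~x
      ; (suc (suc _)) (s≤s (s≤s ())) }

-- The lower bound: four vertices in every unit of H_t.

-- Vertices 1, 2, 5, 6 of a unit have all vertices within distance two inside that unit.
Local : Subset 7 → Fin 7 → Set
Local T a = ∃[ b ] (b Subset.∈ T × UnitAdj a b) ⊎
            ∃[ b ] (Near b × ∃[ c ] (b ≢ c × Near c))
  where
  Near : Fin 7 → Set
  Near c = c Subset.∈ T × c ≢ a × ∃[ b ] (UnitAdj a b × UnitAdj b c)

local? : ∀ T a → Dec (Local T a)
local? T a = Fin.any? (λ b → (b Subset.∈? T) ×-dec unitAdj? a b) ⊎-dec
             Fin.any? (λ b → near? b ×-dec Fin.any? (λ c → ¬? (b Fin.≟ c) ×-dec near? c))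
  where
  near? : ∀ c → Dec _
  near? c = (c Subset.∈? T) ×-dec ¬? (c Fin.≟ a) ×-dec Fin.any? (λ b → unitAdj? a b ×-dec unitAdj? b c)

private-vertices : List (Fin 7)
private-vertices = # 1 ∷ # 2 ∷ # 5 ∷ # 6 ∷ []

quadruples : List (List (Fin 7))
quadruples = map (λ (a , b) → # 2 ∷ # 5 ∷ a ∷ b ∷ [])
  ((# 1 , # 6) ∷ (# 1 , # 4) ∷ (# 1 , # 3) ∷ (# 3 , # 6) ∷ (# 3 , # 4) ∷ (# 3 , # 0) ∷ (# 4 , # 0) ∷ [])

abstract
  -- Vertex 1 has the single neighbour 2 and only vertex 3 at distance two, so 2 is forced, and 5
  -- likewise because of 6. Dominating 2 and 5 themselves then takes two more vertices. The proof
  -- searches all subsets of the unit.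
  four-per-unit : ∀ T → All (Local T) private-vertices → Any (All (Subset._∈ T)) quadruples
  four-per-unit T local = decidable-stable (four? T) λ none → no-bad (T , local , none)
    where
    four? : ∀ T → Dec (Any (All (Subset._∈ T)) quadruples)
    four? T = any? (all? (Subset._∈? T)) quadruples
    no-bad : ¬ (∃[ T ] (All (Local T) private-vertices × ¬ Any (All (Subset._∈ T)) quadruples))
    no-bad = from-no (anySubset? λ T → all? (local? T) private-vertices ×-dec ¬? (four? T))

quadruple-size : All (λ us → Unique us × length us ≡ 4) quadruples
quadruple-size = from-yes (all? (λ us → unique? Fin._≟_ us ×-dec (length us ℕ.≟ 4)) quadruples)

-- A walk can leave the unit only from position 0, so walks of length at most two from private
-- vertices stay inside.
private-closed : All (λ a → a ≢ zero × (∀ b → UnitAdj a b → b ≢ zero)) private-vertices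
private-closed = from-yes (all? (λ a → ¬? (a Fin.≟ zero) ×-dec Fin.all? (λ b → unitAdj? a b →-dec ¬? (b Fin.≟ zero))) private-vertices)

inside-unit : ∀ {t} {i : Fin t} {a y} → a ≢ zero → HAdj (i , a) y → ∃[ b ] (y ≡ (i , b) × UnitAdj a b)
inside-unit {i = i} {a} {j , b} a≢0 e with hadj⁻ {x = i , a} {j , b} e
... | inj₁ (refl , adj)     = b , refl , adj
... | inj₂ (_ , a≡0 , _)    = contradiction a≡0 a≢0

module LowerBound {n t} (G : Graph n) (f : Fin n ↔ (Fin t × Fin 7))
                  (iso : ∀ u v → (Adj G u v ⇔ HAdj (Inverse.to f u) (Inverse.to f v)))
                  (S : Subset n) (dtds : IsDTDS G S) where
  open Inverse f using (to; from; strictlyInverseˡ; strictlyInverseʳ)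

  mark : Fin t → Fin 7 → Subset.Side
  mark i a = does (from (i , a) Subset.∈? S)

  trace : Fin t → Subset 7
  trace i = Vec.tabulate (mark i)

  ∈-trace⁺ : ∀ {x i a} → x Subset.∈ S → to x ≡ (i , a) → a Subset.∈ trace i
  ∈-trace⁺ {x} {i} {a} x∈ eq = Vec.lookup⇒[]= a (trace i) (trans (Vec.lookup∘tabulate (mark i) a)
    (dec-true (from (i , a) Subset.∈? S) (subst (Subset._∈ S) (trans (sym (strictlyInverseʳ x)) (cong from eq)) x∈)))

  ∈-trace⁻ : ∀ {i a} → a Subset.∈ trace i → from (i , a) Subset.∈ S
  ∈-trace⁻ {i} {a} a∈ = does⁻ (from (i , a) Subset.∈? S) (trans (sym (Vec.lookup∘tabulate (mark i) a)) (Vec.[]=⇒lookup a∈))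
    where
    does⁻ : ∀ {P : Set} (d : Dec P) → does d ≡ true → P
    does⁻ (yes p) _ = p

  to-adj : ∀ {x u v} → to u ≡ x → Adj G u v → HAdj x (to v)
  to-adj {u = u} {v} refl = Equivalence.to (iso u v)

  trace-local : ∀ i → All (Local (trace i)) private-vertices
  trace-local i = All.map (λ {a} (a≢0 , closed) → at a a≢0 closed) private-closed
    where
    at : ∀ a → a ≢ zero → (∀ b → UnitAdj a b → b ≢ zero) → Local (trace i) a
    at a a≢0 closed with dtds (from (i , a))
    ... | inj₁ (u , u∈ , adj) with b , eq , e ← inside-unit a≢0 (to-adj (strictlyInverseˡ (i , a)) adj) =
      inj₁ (b , ∈-trace⁺ u∈ eq , e)
    ... | inj₂ (u , w , u∈ , w∈ , u≢w , du , dw) =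
      let b , eqb , nb = near u∈ du ; c , eqc , nc = near w∈ dw in
      inj₂ (b , nb , c , (λ b≡c → u≢w (to-injective (trans eqb (trans (cong (i ,_) b≡c) (sym eqc))))) , nc)
      where
      to-injective : ∀ {u w} → to u ≡ to w → u ≡ w
      to-injective {u} {w} eq = trans (sym (strictlyInverseʳ u)) (trans (cong from eq) (strictlyInverseʳ w))
      near : ∀ {x} → x Subset.∈ S → Dist G (from (i , a)) x 2 →
             ∃[ c ] (to x ≡ (i , c) × (c Subset.∈ trace i × c ≢ a × ∃[ b ] (UnitAdj a b × UnitAdj b c)))
      near {x} x∈ (cons e₁ (cons e₂ nil) , far)
        with b , eq₁ , adj₁ ← inside-unit a≢0 (to-adj (strictlyInverseˡ (i , a)) e₁)
        with c , eq₂ , adj₂ ← inside-unit (closed b adj₁) (to-adj eq₁ e₂) =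
        c , eq₂ , ∈-trace⁺ x∈ eq₂ ,
        (λ { refl → far 0 (s≤s z≤n) (subst (λ y → Walk G y x 0) (trans (sym (strictlyInverseʳ x)) (cong from eq₂)) nil) }) ,
        b , adj₁ , adj₂

  -- Membership of the first coordinates in `is` is carried along to show that the vertices of a new
  -- unit are distinct from those already collected.
  collect : ∀ is → Unique is → ∃[ L ] (Unique L × All (λ p → from p Subset.∈ S × proj₁ p ∈ is) L × length L ≡ 4 * length is)
  collect [] _ = [] , [] , [] , refl
  collect (i ∷ is) (i∉ ∷ u) with L , uL , L∈ , eqL ← collect is u
    with us , us∈ , all∈ ← find (four-per-unit (trace i) (trace-local i))
    with uus , eq4 ← All.lookup quadruple-size us∈ =
    map (i ,_) us ++ L ,
    Unique.++⁺ (Unique.map⁺ (cong proj₂) uus) uL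
      (λ (p∈us , p∈L) → let _ , _ , eq = ∈-map⁻ (i ,_) p∈us in
        All.lookup i∉ (proj₂ (All.lookup L∈ p∈L)) (sym (cong proj₁ eq))) ,
    All.++⁺ (All.map⁺ (All.map (λ a∈ → ∈-trace⁻ a∈ , here refl) all∈)) (All.map (λ (p∈ , i∈) → p∈ , there i∈) L∈) ,
    (begin
      length (map (i ,_) us ++ L)          ≡⟨ length-++ (map (i ,_) us) ⟩
      length (map (i ,_) us) + length L    ≡⟨ cong₂ _+_ (trans (length-map (i ,_) us) eq4) eqL ⟩
      4 + 4 * length is                    ≡⟨ sym (*-suc 4 (length is)) ⟩
      4 * length (i ∷ is)                  ∎)
    where open ≡-Reasoning

  lower-bound : 4 * t ≤ ∣ S ∣
  lower-bound with L , uL , L∈ , eq ← collect (allFin t) (Unique.allFin⁺ t) = begin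
    4 * t                    ≡⟨ cong (4 *_) {t} {length (allFin t)} (sym (length-tabulate id)) ⟩
    4 * length (allFin t)    ≡⟨ sym eq ⟩
    length L                 ≡⟨ sym (length-map from L) ⟩
    length (map from L)      ≤⟨ unique-length (Unique.map⁺ from-injective uL) (All.map⁺ (All.map proj₁ L∈)) ⟩
    ∣ S ∣                    ∎
    where
    open ≤-Reasoning
    from-injective : ∀ {p q} → from p ≡ from q → p ≡ q
    from-injective {p} {q} eq = trans (sym (strictlyInverseˡ p)) (trans (cong to eq) (strictlyInverseˡ q))

-- The equality case and the assembly of the theorem.

-- The partition gives n = 7t, so equality means k = 4t. Then no dominating list is shorter than 4t,
-- which is the minimality that excludes edges beyond those of H_t.
inH : ∀ {m} (G : Graph (suc m)) (cf : ClawFree G) k → IsGammaTD G k → 7 * k ≡ 4 * suc m →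
  let open Spanning G cf ; open Unfolding _~_ ~-sym in
  SpanningH (allFin (suc m)) → InH G
inH {m} G cf k (_ , least) 7k≡4n spans = t , ≤-trans (s≤s z≤n) 3≤members ,
  mk↔ₛ′ index (entry members) (λ q → entry-injective members uniq (entry-index (entry members q))) entry-index ,
  λ u v → mk⇔ (λ u~v → hadj⁺ {x = index u} {index v} (rigid irreflexive minimal (subst₂ _~_ (sym (entry-index u)) (sym (entry-index v)) u~v)))
              (λ e → subst₂ _~_ (entry-index u) (entry-index v) (hom (hadj⁻ {x = index u} {index v} e)))
  where
  open Spanning G cf
  open Unfolding _~_ ~-sym
  open SpanningH spans
  n = suc m
  t = length members
  uniq : Unique (concatMap toList members)
  uniq = unique-resp-↭ (↭-sym partition) (Unique.allFin⁺ n)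
  surjective : ∀ v → ∃[ q ] entry members q ≡ v
  surjective v = entry-surjective members (∈-resp-↭ (↭-sym partition) (∈-allFin v))
  index : Fin n → Fin t × Fin 7
  index v = proj₁ (surjective v)
  entry-index : ∀ v → entry members (index v) ≡ v
  entry-index v = proj₂ (surjective v)
  head≡lookup : ∀ {A : Set} {l} (x : Vec A (suc l)) → head x ≡ lookup x zero
  head≡lookup (_ ∷ _) = refl
  hom : ∀ {x y} → HAdj′ x y → entry members x ~ entry members y
  hom {i , a} (inj₁ (refl , adj)) = All.lookup areUnits (∈-lookup i) _ _ adj
  hom {i , _} {j , _} (inj₂ (i≢j , refl , refl)) =
    subst₂ _~_ (head≡lookup (List.lookup members i)) (head≡lookup (List.lookup members j)) (allPairs-lookup ~-sym hubs-adj i≢j)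
  n≡7t : n ≡ 7 * t
  n≡7t = trans (sym (trans (↭-length partition) (length-tabulate id))) (length-concatMap-toList members)
  k≡4t : k ≡ 4 * t
  k≡4t = *-cancelˡ-≡ k (4 * t) 7 (trans 7k≡4n (trans (cong (4 *_) n≡7t) (trans (sym (*-assoc 4 7 t)) (*-assoc 7 4 t))))
  open Domination _~_
  minimal : ∀ T → (∀ v → Dominated T v) → 4 * t ≤ length T
  minimal T dom = ≤-trans (≤-reflexive (sym k≡4t)) (≤-trans (least (fromList T) (dominated⇒DTDS G T dom)) (∣fromList∣≤length T))
  irreflexive : ∀ {v} → ¬ v ~ v
  irreflexive {v} v~v with () ← trans (sym v~v) (Graph.irrefl G v)
  open Rigidity _~_ 3≤members (entry members) (entry-injective members uniq) surjective (λ {x} {y} → hom {x} {y}) ~-sym using (rigid)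

module _ {m} (G : Graph (suc m)) (cf : ClawFree G) where
  open Spanning G cf
  open CliqueForest _~_ ~-sym
  open Labelling _~_ ~-sym
  open Unfolding _~_ ~-sym
  open Domination _~_

  forest-bound : ∀ {r F} → Valid r F → r ∷ verts F ↭ allFin (suc m) → 14 < suc m →
    ∃[ S ] ((∀ v → Dominated S v) × 7 * length S ≤ 4 * suc m × (7 * length S < 4 * suc m ⊎ SpanningH (allFin (suc m))))
  forest-bound {r} {F} vF perm 14<n =
    let S , dom , le , alt = dominating vF (unique-resp-↭ (↭-sym perm) (Unique.allFin⁺ _)) (subst (14 <_) (sym size) 14<n) in
    S , (λ v → All.lookup dom (∈-resp-↭ (↭-sym perm) (∈-allFin v))) , subst (λ l → 7 * length S ≤ 4 * l) size le ,
    [ inj₁ ∘ subst (λ l → 7 * length S < 4 * l) size , (λ shape → inj₂ (spanningH shape vF perm)) ]′ alt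
    where
    size : suc (length (verts F)) ≡ suc m
    size = trans (↭-length perm) (length-tabulate id)

  upper-bound : Connected G → 14 < suc m →
    ∃[ S ] ((∀ v → Dominated S v) × 7 * length S ≤ 4 * suc m × (7 * length S < 4 * suc m ⊎ SpanningH (allFin (suc m))))
  -- The search may start at any vertex, since the forest is rerooted afterwards.
  upper-bound connected 14<n = let _ , _ , vF , perm = spanning-forest {zero} ↭-refl connected in forest-bound vF perm 14<n

mainTheorem3 : ∀ (n : ℕ) (G : Graph n) → Connected G → ClawFree G → 14 < n →
    ∀ k → IsGammaTD G k → (7 * k ≤ 4 * n) × ((7 * k ≡ 4 * n) ⇔ InH G)
mainTheorem3 (suc m) G connected cf 14<n k γ@((S₀ , S₀-dtds , ∣S₀∣≡k) , least)
  with S , dom , le , alt ← upper-bound G cf connected 14<n = 7k≤4n , mk⇔ (extremal alt) attained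
  where
  n = suc m
  open Unfolding (Adj G) (Spanning.~-sym G cf)
  7k≤7∣S∣ : 7 * k ≤ 7 * length S
  7k≤7∣S∣ = *-monoʳ-≤ 7 (≤-trans (least (fromList S) (dominated⇒DTDS G S dom)) (∣fromList∣≤length S))
  7k≤4n : 7 * k ≤ 4 * n
  7k≤4n = ≤-trans 7k≤7∣S∣ le
  extremal : 7 * length S < 4 * n ⊎ SpanningH (allFin n) → 7 * k ≡ 4 * n → InH G
  extremal (inj₁ lt)    eq = contradiction eq (<⇒≢ (≤-<-trans 7k≤7∣S∣ lt))
  extremal (inj₂ spans) eq = inH G cf k γ eq spans
  attained : InH G → 7 * k ≡ 4 * n
  attained (t , _ , f , iso) = ≤-antisym 7k≤4n (begin
    4 * n          ≡⟨ cong (4 *_) (↔⇒≡ (↔-sym Fin.*↔× ↔-∘ f)) ⟩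
    4 * (t * 7)    ≡⟨ sym (*-assoc 4 t 7) ⟩
    4 * t * 7      ≡⟨ *-comm (4 * t) 7 ⟩
    7 * (4 * t)    ≤⟨ *-monoʳ-≤ 7 (LowerBound.lower-bound G f iso S₀ S₀-dtds) ⟩
    7 * ∣ S₀ ∣     ≡⟨ cong (7 *_) ∣S₀∣≡k ⟩
    7 * k          ∎)
    where open ≤-Reasoning
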